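{- Let $\mathbb{Q}$ be the countable dense linear order without endpoints. Then $$\mathrm{Aut}(\mathrm{Aut}(\mathbb{Q}))\cong \mathrm{Aut}(\mathbb{Q})\rtimes\mathbb{Z}_2.$$
   Context: $\mathrm{Aut}(\mathbb{Q})$ is the group of order-preserving bijections of $\mathbb{Q}$; $\mathrm{Aut}(\mathrm{Aut}(\mathbb{Q}))$ is the group of all (abstract) group automorphisms of $\mathrm{Aut}(\mathbb{Q})$; $\mathbb{Z}_2$ is the cyclic group of order $2$. -}

module Defs where

open import Algebra.Bundles using (Group)
open import Algebra.Morphism.Bundles using (GroupHomomorphism)
open import Algebra.Morphism.Structures using (IsGroupIsomorphism)
open import Algebra.Properties.Group using (⁻¹-involutive)
import Algebra.Morphism.Construct.Composition as GroupComp
import Algebra.Morphism.Construct.Identity as GroupId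
open import Data.Parity.Base as ℙ using (Parity; 0ℙ; 1ℙ)
open import Data.Parity.Properties using (+-0-group)
open import Data.Product.Base using (_×_; _,_; proj₁; proj₂)
open import Data.Product.Relation.Binary.Pointwise.NonDependent using (Pointwise; ×-isEquivalence)
open import Data.Rational.Base as ℚ using (-_)
open import Data.Rational.Properties as ℚ
  using (≤-decTotalOrder; neg-antimono-≤; neg-injective)
open import Function.Base using (_∘_)
open import Level using (Level; 0ℓ; _⊔_)
open import Relation.Binary.Bundles using (Poset; DecTotalOrder)
open import Relation.Binary.Morphism.Structures using (IsOrderIsomorphism)
import Relation.Binary.Morphism.Construct.Composition as OrderComp
import Relation.Binary.Morphism.Construct.Identity as OrderId
open import Relation.Binary.PropositionalEquality
  using (_≡_; refl; sym; trans; cong; subst₂)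
import Relation.Binary.Reasoning.Setoid as SetoidReasoning

private
  variable
    a b c ℓ ℓ₁ ℓ₂ ℓ₃ ℓ₄ : Level

record OrderAutomorphism (P : Poset c ℓ₁ ℓ₂) : Set (c ⊔ ℓ₁ ⊔ ℓ₂) where
  open Poset P
  field
    ⟦_⟧                : Carrier → Carrier
    isOrderIsomorphism : IsOrderIsomorphism _≈_ _≈_ _≤_ _≤_ ⟦_⟧

  open IsOrderIsomorphism isOrderIsomorphism public
    hiding (module Eq) renaming (cong to ⟦⟧-cong)

  inv : Carrier → Carrier
  inv y = proj₁ (surjective y)

  inverseˡ : ∀ y → ⟦ inv y ⟧ ≈ y
  inverseˡ y = proj₂ (surjective y) Eq.refl

  inverseʳ : ∀ x → inv ⟦ x ⟧ ≈ x
  inverseʳ x = injective (inverseˡ ⟦ x ⟧)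

record _≅_ (G : Group a ℓ₁) (H : Group b ℓ₂) : Set (a ⊔ b ⊔ ℓ₁ ⊔ ℓ₂) where
  private
    module G = Group G
    module H = Group H
  field
    ⟦_⟧                : G.Carrier → H.Carrier
    isGroupIsomorphism : IsGroupIsomorphism G.rawGroup H.rawGroup ⟦_⟧

  open IsGroupIsomorphism isGroupIsomorphism public

  inv : H.Carrier → G.Carrier
  inv y = proj₁ (surjective y)

  inverseˡ : ∀ y → ⟦ inv y ⟧ H.≈ y
  inverseˡ y = proj₂ (surjective y) G.refl

  inverseʳ : ∀ x → inv ⟦ x ⟧ G.≈ x
  inverseʳ x = injective (inverseˡ ⟦ x ⟧)

infix 4 _≅_

-- Automorphisms of a poset or of a group are identified when they agree
-- pointwise, so no function extensionality or proof irrelevance is needed.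

OrderAut : Poset c ℓ₁ ℓ₂ → Group (c ⊔ ℓ₁ ⊔ ℓ₂) (c ⊔ ℓ₁)
OrderAut P = record
  { Carrier = OrderAutomorphism P
  ; _≈_     = λ f g → ∀ x → ⟦ f ⟧ x ≈ ⟦ g ⟧ x
  ; _∙_     = λ f g → record
    { ⟦_⟧ = ⟦ f ⟧ ∘ ⟦ g ⟧
    ; isOrderIsomorphism = OrderComp.isOrderIsomorphism Eq.trans
        (isOrderIsomorphism g) (isOrderIsomorphism f)
    }
  ; ε       = record
    { ⟦_⟧ = λ x → x
    ; isOrderIsomorphism = OrderId.isOrderIsomorphism _≈_ _≤_ Eq.refl
    }
  ; _⁻¹     = inverse
  ; isGroup = record
    { isMonoid = record
      { isSemigroup = record
        { isMagma = record
          { isEquivalence = record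
            { refl  = λ _ → Eq.refl
            ; sym   = λ p x → Eq.sym (p x)
            ; trans = λ p q x → Eq.trans (p x) (q x)
            }
          ; ∙-cong = λ {f} {_} {_} {k} p q x →
              Eq.trans (⟦⟧-cong f (q x)) (p (⟦ k ⟧ x))
          }
        ; assoc = λ _ _ _ _ → Eq.refl
        }
      ; identity = (λ _ _ → Eq.refl) , (λ _ _ → Eq.refl)
      }
    ; inverse = inverseʳ , inverseˡ
    ; ⁻¹-cong = λ {f} {g} p x → injective f
        (Eq.trans (inverseˡ f x)
          (Eq.sym (Eq.trans (p (inv g x)) (inverseˡ g x))))
    }
  }
  where
  open Poset P
  open OrderAutomorphism

  inverse : OrderAutomorphism P → OrderAutomorphism P
  inverse f = record
    { ⟦_⟧ = inv f
    ; isOrderIsomorphism = record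
      { isOrderMonomorphism = record
        { isOrderHomomorphism = record
          { cong = inv-cong
          ; mono = λ {x} {y} x≤y → cancel f
              (≤-respˡ-≈ (Eq.sym (inverseˡ f x))
                (≤-respʳ-≈ (Eq.sym (inverseˡ f y)) x≤y))
          }
        ; injective = λ {x} {y} p →
            Eq.trans (Eq.sym (inverseˡ f x)) (Eq.trans (⟦⟧-cong f p) (inverseˡ f y))
        ; cancel = λ {x} {y} p →
            ≤-respˡ-≈ (inverseˡ f x) (≤-respʳ-≈ (inverseˡ f y) (mono f p))
        }
      ; surjective = λ x → ⟦ f ⟧ x , λ p → Eq.trans (inv-cong p) (inverseʳ f x)
      }
    }
    where
    inv-cong : ∀ {x y} → x ≈ y → inv f x ≈ inv f y
    inv-cong {x} {y} p = injective f
      (Eq.trans (inverseˡ f x) (Eq.trans p (Eq.sym (inverseˡ f y))))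

GroupAut : Group c ℓ → Group (c ⊔ ℓ) (c ⊔ ℓ)
GroupAut G = record
  { Carrier = G ≅ G
  ; _≈_     = λ φ ψ → ∀ x → ⟦ φ ⟧ x ≈ ⟦ ψ ⟧ x
  ; _∙_     = λ φ ψ → record
    { ⟦_⟧ = ⟦ φ ⟧ ∘ ⟦ ψ ⟧
    ; isGroupIsomorphism = GroupComp.isGroupIsomorphism G.trans
        (isGroupIsomorphism ψ) (isGroupIsomorphism φ)
    }
  ; ε       = record
    { ⟦_⟧ = λ x → x
    ; isGroupIsomorphism = GroupId.isGroupIsomorphism rawGroup G.refl
    }
  ; _⁻¹     = inverse′
  ; isGroup = record
    { isMonoid = record
      { isSemigroup = record
        { isMagma = record
          { isEquivalence = record
            { refl  = λ _ → G.refl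
            ; sym   = λ p x → G.sym (p x)
            ; trans = λ p q x → G.trans (p x) (q x)
            }
          ; ∙-cong = λ {φ} {_} {_} {χ} p q x →
              G.trans (⟦⟧-cong φ (q x)) (p (⟦ χ ⟧ x))
          }
        ; assoc = λ _ _ _ _ → G.refl
        }
      ; identity = (λ _ _ → G.refl) , (λ _ _ → G.refl)
      }
    ; inverse = inverseʳ , inverseˡ
    ; ⁻¹-cong = λ {φ} {ψ} p x → injective φ
        (G.trans (inverseˡ φ x)
          (G.sym (G.trans (p (inv ψ x)) (inverseˡ ψ x))))
    }
  }
  where
  module G = Group G
  open G using (_≈_; _∙_; _⁻¹; rawGroup; setoid)
  open _≅_ renaming (⁻¹-homo to ⟦⟧-⁻¹; ∙-homo to ⟦⟧-∙; ε-homo to ⟦⟧-ε)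
  open SetoidReasoning setoid

  inverse′ : G ≅ G → G ≅ G
  inverse′ φ = record
    { ⟦_⟧ = inv φ
    ; isGroupIsomorphism = record
      { isGroupMonomorphism = record
        { isGroupHomomorphism = record
          { isMonoidHomomorphism = record
            { isMagmaHomomorphism = record
              { isRelHomomorphism = record { cong = inv-cong }
              ; homo = λ x y → injective φ (begin
                  ⟦ φ ⟧ (inv φ (x ∙ y))                ≈⟨ inverseˡ φ (x ∙ y) ⟩
                  x ∙ y                                ≈⟨ G.∙-cong (inverseˡ φ x) (inverseˡ φ y) ⟨
                  ⟦ φ ⟧ (inv φ x) ∙ ⟦ φ ⟧ (inv φ y)    ≈⟨ ⟦⟧-∙ φ (inv φ x) (inv φ y) ⟨
                  ⟦ φ ⟧ (inv φ x ∙ inv φ y)            ∎)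
              }
            ; ε-homo = injective φ (G.trans (inverseˡ φ G.ε) (G.sym (⟦⟧-ε φ)))
            }
          ; ⁻¹-homo = λ x → injective φ (begin
              ⟦ φ ⟧ (inv φ (x ⁻¹))    ≈⟨ inverseˡ φ (x ⁻¹) ⟩
              x ⁻¹                    ≈⟨ G.⁻¹-cong (inverseˡ φ x) ⟨
              ⟦ φ ⟧ (inv φ x) ⁻¹      ≈⟨ ⟦⟧-⁻¹ φ (inv φ x) ⟨
              ⟦ φ ⟧ (inv φ x ⁻¹)      ∎)
          }
        ; injective = λ {x} {y} p →
            G.trans (G.sym (inverseˡ φ x)) (G.trans (⟦⟧-cong φ p) (inverseˡ φ y))
        }
      ; surjective = λ x → ⟦ φ ⟧ x , λ p → G.trans (inv-cong p) (inverseʳ φ x)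
      }
    }
    where
    inv-cong : ∀ {x y} → x ≈ y → inv φ x ≈ inv φ y
    inv-cong {x} {y} p = injective φ
      (G.trans (inverseˡ φ x) (G.trans p (G.sym (inverseˡ φ y))))

Action : Group a ℓ₁ → Group b ℓ₂ → Set (a ⊔ b ⊔ ℓ₁ ⊔ ℓ₂)
Action H N = GroupHomomorphism (Group.rawGroup H) (Group.rawGroup (GroupAut N))

SemidirectProduct : (N : Group a ℓ₁) (H : Group b ℓ₂) → Action H N → Group (a ⊔ b) (ℓ₁ ⊔ ℓ₂)
SemidirectProduct N H θ = record
  { Carrier = N.Carrier × H.Carrier
  ; _≈_     = Pointwise N._≈_ H._≈_
  ; _∙_     = λ (n , h) (n′ , h′) → n N.∙ act h n′ , h H.∙ h′
  ; ε       = N.ε , H.ε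
  ; _⁻¹     = λ (n , h) → act (h H.⁻¹) (n N.⁻¹) , h H.⁻¹
  ; isGroup = record
    { isMonoid = record
      { isSemigroup = record
        { isMagma = record
          { isEquivalence = ×-isEquivalence N.isEquivalence H.isEquivalence
          ; ∙-cong = λ (p , q) (p′ , q′) → N.∙-cong p (act-cong q p′) , H.∙-cong q q′
          }
        ; assoc = λ (n , h) (n′ , h′) (n″ , h″) → (begin
              (n N.∙ act h n′) N.∙ act (h H.∙ h′) n″
                ≈⟨ N.assoc _ _ _ ⟩
              n N.∙ (act h n′ N.∙ act (h H.∙ h′) n″)
                ≈⟨ N.∙-congˡ (N.∙-congˡ (θ.homo h h′ n″)) ⟩
              n N.∙ (act h n′ N.∙ act h (act h′ n″))
                ≈⟨ N.∙-congˡ (∙-homo (θ.⟦ h ⟧) n′ (act h′ n″)) ⟨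
              n N.∙ act h (n′ N.∙ act h′ n″)
                ∎) , H.assoc h h′ h″
        }
      ; identity
          = (λ (n , h) → N.trans (N.identityˡ _) (θ.ε-homo n) , H.identityˡ h)
          , (λ (n , h) → N.trans (N.∙-congˡ (ε-homo θ.⟦ h ⟧)) (N.identityʳ n) , H.identityʳ h)
      }
    ; inverse
        = (λ (n , h) → (begin
              act (h H.⁻¹) (n N.⁻¹) N.∙ act (h H.⁻¹) n
                ≈⟨ ∙-homo θ.⟦ h H.⁻¹ ⟧ (n N.⁻¹) n ⟨
              act (h H.⁻¹) (n N.⁻¹ N.∙ n)
                ≈⟨ ⟦⟧-cong θ.⟦ h H.⁻¹ ⟧ (N.inverseˡ n) ⟩
              act (h H.⁻¹) N.ε
                ≈⟨ ε-homo θ.⟦ h H.⁻¹ ⟧ ⟩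
              N.ε
                ∎) , H.inverseˡ h)
        , (λ (n , h) → (begin
              n N.∙ act h (act (h H.⁻¹) (n N.⁻¹))
                ≈⟨ N.∙-congˡ (θ.homo h (h H.⁻¹) (n N.⁻¹)) ⟨
              n N.∙ act (h H.∙ h H.⁻¹) (n N.⁻¹)
                ≈⟨ N.∙-congˡ (θ.⟦⟧-cong (H.inverseʳ h) (n N.⁻¹)) ⟩
              n N.∙ act H.ε (n N.⁻¹)
                ≈⟨ N.∙-congˡ (θ.ε-homo (n N.⁻¹)) ⟩
              n N.∙ n N.⁻¹
                ≈⟨ N.inverseʳ n ⟩
              N.ε
                ∎) , H.inverseʳ h)
    ; ⁻¹-cong = λ (p , q) → act-cong (H.⁻¹-cong q) (N.⁻¹-cong p) , H.⁻¹-cong q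
    }
  }
  where
  module N = Group N
  module H = Group H
  module θ = GroupHomomorphism θ
  open _≅_
  open SetoidReasoning N.setoid

  act : H.Carrier → N.Carrier → N.Carrier
  act h = ⟦ θ.⟦ h ⟧ ⟧

  act-cong : ∀ {h h′ n n′} → h H.≈ h′ → n N.≈ n′ → act h n N.≈ act h′ n′
  act-cong {h} {n′ = n′} p q = N.trans (⟦⟧-cong θ.⟦ h ⟧ q) (θ.⟦⟧-cong p n′)

neg-involutive : ∀ x → - - x ≡ x
neg-involutive = ⁻¹-involutive ℚ.+-0-group

neg-cancel-≤ : ∀ {x y} → - x ℚ.≤ - y → y ℚ.≤ x
neg-cancel-≤ {x} {y} p =
  subst₂ ℚ._≤_ (neg-involutive y) (neg-involutive x) (neg-antimono-≤ p)

Autℚ : Group 0ℓ 0ℓ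
Autℚ = OrderAut (DecTotalOrder.poset ≤-decTotalOrder)

ℤ₂ : Group 0ℓ 0ℓ
ℤ₂ = +-0-group

-- f ↦ σ f σ⁻¹ for the order-reversing involution σ x = - x.
conjNeg : Autℚ ≅ Autℚ
conjNeg = record
  { ⟦_⟧ = conj
  ; isGroupIsomorphism = record
    { isGroupMonomorphism = record
      { isGroupHomomorphism = record
        { isMonoidHomomorphism = record
          { isMagmaHomomorphism = record
            { isRelHomomorphism = record { cong = λ p x → cong -_ (p (- x)) }
            ; homo = λ f g x → cong (λ y → - ⟦ f ⟧ y) (sym (neg-involutive (⟦ g ⟧ (- x))))
            }
          ; ε-homo = neg-involutive
          }
        ; ⁻¹-homo = λ _ _ → refl
        }
      ; injective = λ {f} {g} p x → neg-injective
          (subst₂ (λ y z → - ⟦ f ⟧ y ≡ - ⟦ g ⟧ z)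
            (neg-involutive x) (neg-involutive x) (p (- x)))
      }
    ; surjective = λ f → conj f , λ p x →
        trans (cong -_ (p (- x))) (conj-involutive f x)
    }
  }
  where
  open OrderAutomorphism

  conj : OrderAutomorphism _ → OrderAutomorphism _
  conj f = record
    { ⟦_⟧ = λ x → - ⟦ f ⟧ (- x)
    ; isOrderIsomorphism = record
      { isOrderMonomorphism = record
        { isOrderHomomorphism = record
          { cong = cong (λ x → - ⟦ f ⟧ (- x))
          ; mono = λ p → neg-antimono-≤ (mono f (neg-antimono-≤ p))
          }
        ; injective = λ p → neg-injective (injective f (neg-injective p))
        ; cancel    = λ p → neg-cancel-≤ (cancel f (neg-cancel-≤ p))
        }
      ; surjective = λ y → - inv f (- y) , λ { refl →
          trans (cong (λ x → - ⟦ f ⟧ x) (neg-involutive (inv f (- y))))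
            (trans (cong -_ (inverseˡ f (- y))) (neg-involutive y)) }
      }
    }

  conj-involutive : ∀ f x → - - ⟦ f ⟧ (- - x) ≡ ⟦ f ⟧ x
  conj-involutive f x =
    trans (neg-involutive (⟦ f ⟧ (- - x))) (cong ⟦ f ⟧ (neg-involutive x))

-- With this action, the semidirect product is the group of all order-preserving
-- or order-reversing permutations of ℚ, (f , 1ℙ) standing for x ↦ f (- x).
negAction : Action ℤ₂ Autℚ
negAction = record
  { ⟦_⟧ = act
  ; isGroupHomomorphism = record
    { isMonoidHomomorphism = record
      { isMagmaHomomorphism = record
        { isRelHomomorphism = record { cong = λ { {h} refl f x → refl } }
        ; homo = homo
        }
      ; ε-homo = λ _ _ → refl
      }
    ; ⁻¹-homo = λ { 0ℙ _ _ → refl ; 1ℙ _ _ → refl }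
    }
  }
  where
  open OrderAutomorphism using (⟦_⟧)
  module AutAut = Group (GroupAut Autℚ)

  act : Parity → Autℚ ≅ Autℚ
  act 0ℙ = AutAut.ε
  act 1ℙ = conjNeg

  homo : ∀ h h′ → act (h ℙ.+ h′) AutAut.≈ act h AutAut.∙ act h′
  homo 0ℙ _ _ _ = refl
  homo 1ℙ 0ℙ _ _ = refl
  homo 1ℙ 1ℙ f x = sym (trans (neg-involutive (⟦ f ⟧ (- - x)))
    (cong ⟦ f ⟧ (neg-involutive x)))

{-# OPTIONS --safe #-}
module Submission where

-- Let ψ be an automorphism of G = Aut(ℚ). Disjointness of supports is expressible in the
-- group G (Rubin's algebraic disjointness), hence preserved by ψ. Given z, at most one of
-- two disjoint automorphisms g has ψ(g) moving z, so the points c such that ψ(g) fixes z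
-- for every g supported below c form a cut of ℚ, on which G acts compatibly with its
-- action on z through ψ. The order of two points then depends only on the order of their
-- cuts, in the same way for all pairs, and distinct points have distinct cuts. The cut of z
-- is not a gap, because countably many gaps cannot be permuted by all of Aut(ℚ), so it is
-- given by a point θ z, and θ is an increasing or decreasing bijection with θ ψ(g) = g θ.

open import Defs
open import Algebra.Bundles using (Group)
open import Algebra.Morphism.Bundles using (GroupHomomorphism)
open import Axiom.ExcludedMiddle using (ExcludedMiddle)
open import Data.Empty using (⊥-elim)
open import Data.Fin.Base using (Fin; toℕ)
open import Data.Fin.Patterns using (0F; 1F; 2F; 3F)
open import Data.Fin.Properties using (pigeonhole)
open import Data.Integer.Base as ℤ using (ℤ; +_; -[1+_])
open import Data.List.Base as List using (List; []; _∷_)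
open import Data.List.Membership.Propositional using (_∈_)
open import Data.List.Membership.Propositional.Properties using (∈-map⁺)
open import Data.List.Relation.Binary.Subset.Propositional using (_⊆_)
open import Data.List.Relation.Unary.All as All using (All; []; _∷_)
open import Data.List.Relation.Unary.AllPairs as AllPairs using (AllPairs; []; _∷_)
import Data.List.Relation.Unary.AllPairs.Properties as AllPairs
open import Data.List.Relation.Unary.Any using (here; there)
open import Data.Nat.Base as ℕ using (ℕ; zero; suc)
import Data.Nat.Properties as ℕ
open import Data.Parity.Base using (Parity; 0ℙ; 1ℙ)
open import Data.Product.Base using (∃; ∃₂; Σ; _×_; _,_; proj₁; proj₂; map₂; swap)
open import Data.Rational.Base as ℚ using (ℚ; _<_; _≤_; 0ℚ; 1ℚ; -_)
open import Data.Rational.Properties as ℚ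
  using (<-cmp; <-dense; <-trans; <-irrefl; <-asym; <⇒≤; ≤-refl; ≤-total; ≤-antisym;
         <-≤-trans; ≤-<-trans; ≮⇒≥; ≰⇒>)
open import Data.Sum.Base using (_⊎_; inj₁; inj₂; [_,_]′)
open import Data.Unit.Base using (⊤; tt)
open import Function.Base using (_∘_; id)
open import Level using (0ℓ; _⊔_)
open import Relation.Binary.Definitions using (tri<; tri≈; tri>)
open import Relation.Binary.PropositionalEquality
  using (_≡_; _≢_; refl; sym; trans; cong; subst; subst₂)
open import Relation.Nullary using (¬_; Dec; yes; no; contradiction)

-- Commuting alone cannot detect disjointness, since every automorphism commutes with its own
-- powers; hence the test against all `h` that do not commute with `f`. Conjugation by x ↦ -x is an
-- automorphism that reverses the order, so the order can be recovered only up to one global choice.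
-- The choice is the same for all pairs because the stabiliser of a point y, acting through `ψ`, is
-- transitive on the points whose cut lies below that of y. Points with the same cut form convex
-- classes, and a map moving points only inside one class would preserve every cut and so be
-- trivial. Gaps need a separate argument, a matter of cardinality: one gap can be moved to
-- uncountably many others, whereas the orbit of z stays in ℚ.

private
  module G = Group Autℚ
  open OrderAutomorphism using (⟦_⟧; mono; injective; inverseˡ; inverseʳ)

Aut : Set
Aut = G.Carrier

infixr 7 _·_
_·_ : Aut → ℚ → ℚ
g · x = ⟦ g ⟧ x

-- Algebraic disjointness in an abstract group

module _ {c ℓ} (G : Group c ℓ) where
  open Group G

  Commute : Carrier → Carrier → Set ℓ
  Commute f g = f ∙ g ≈ g ∙ f

  commutator : Carrier → Carrier → Carrier
  commutator f g = f ∙ (g ∙ (f ⁻¹ ∙ g ⁻¹))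

  -- In Aut(ℚ) this says that f and g have disjoint supports.
  AlgDisjoint : Carrier → Carrier → Set (c ⊔ ℓ)
  AlgDisjoint f g = ∀ h → ¬ Commute f h → ∃₂ λ a b → Commute a g × Commute b g ×
    Commute (commutator a (commutator b h)) g × ¬ commutator a (commutator b h) ≈ ε

module _ {c ℓ} {G : Group c ℓ} (ψ : G ≅ G) where
  open Group G using (_∙_; _⁻¹; _≈_) renaming (∙-cong to ∙-cong₂)
  private module G′ = Group G
  open _≅_ ψ renaming
    (⟦_⟧ to ψ[_]; ⟦⟧-cong to ψ-cong; inv to ψ⁻¹; inverseˡ to ψψ⁻¹; injective to ψ-injective)

  Commute-image : ∀ {f g} → Commute G f g → Commute G ψ[ f ] ψ[ g ]
  Commute-image {f} {g} p = G′.trans (G′.sym (∙-homo f g)) (G′.trans (ψ-cong p) (∙-homo g f))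

  Commute-cong : ∀ {f f′ g g′} → f ≈ f′ → g ≈ g′ → Commute G f g → Commute G f′ g′
  Commute-cong p q r = G′.trans (∙-cong₂ (G′.sym p) (G′.sym q)) (G′.trans r (∙-cong₂ q p))

  commutator-image : ∀ f {g g′} → ψ[ g ] ≈ g′ → ψ[ commutator G f g ] ≈ commutator G ψ[ f ] g′
  commutator-image f {g} p = G′.trans (∙-homo _ _) (G′.∙-congˡ (G′.trans (∙-homo _ _) (∙-cong₂ p
    (G′.trans (∙-homo _ _) (∙-cong₂ (⁻¹-homo f) (G′.trans (⁻¹-homo g) (G′.⁻¹-cong p)))))))

  -- The condition is built from equations between words. The test element `h` is pulled back by
  -- `ψ⁻¹`, the witnesses are pushed forward, and injectivity of `ψ` keeps the commutator
  -- nontrivial.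
  AlgDisjoint-image : ∀ {f g} → AlgDisjoint G f g → AlgDisjoint G ψ[ f ] ψ[ g ]
  AlgDisjoint-image {f} {g} f⊥g h ¬fh =
    let a , b , ag , bg , kg , k≢ε = f⊥g (ψ⁻¹ h)
          (λ p → ¬fh (Commute-cong G′.refl (ψψ⁻¹ h) (Commute-image p)))
        k-image = commutator-image a (commutator-image b (ψψ⁻¹ h))
    in ψ[ a ] , ψ[ b ] , Commute-image ag , Commute-image bg
      , Commute-cong k-image G′.refl (Commute-image kg)
      , λ p → k≢ε (ψ-injective (G′.trans k-image (G′.trans p (G′.sym ε-homo))))

-- Elementary facts on ℚ and its automorphisms

x<x+1 : ∀ x → x < x ℚ.+ 1ℚ
x<x+1 x = subst (_< x ℚ.+ 1ℚ) (ℚ.+-identityʳ x) (ℚ.+-monoʳ-< x (ℚ.positive⁻¹ 1ℚ))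

-- Opaque, since unfolding the witnesses to rational arithmetic makes terms explode.
abstract
  dense : ∀ {x y} → x < y → ∃ λ z → x < z × z < y
  dense = <-dense

  <-unbounded : ∀ x → ∃ λ y → x < y
  <-unbounded x = x ℚ.+ 1ℚ , x<x+1 x

  >-unbounded : ∀ x → ∃ λ y → y < x
  >-unbounded x = - (- x ℚ.+ 1ℚ) ,
    subst (- (- x ℚ.+ 1ℚ) <_) (neg-involutive x) (ℚ.neg-antimono-< (x<x+1 (- x)))

  common-upper : ∀ x y → ∃ λ u → x < u × y < u
  common-upper x y with ≤-total x y
  ... | inj₁ x≤y = let u , y<u = <-unbounded y in u , ≤-<-trans x≤y y<u , y<u
  ... | inj₂ y≤x = let u , x<u = <-unbounded x in u , x<u , ≤-<-trans y≤x x<u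

  common-lower : ∀ x y → ∃ λ l → l < x × l < y
  common-lower x y with ≤-total x y
  ... | inj₁ x≤y = let l , l<x = >-unbounded x in l , l<x , <-≤-trans l<x x≤y
  ... | inj₂ y≤x = let l , l<y = >-unbounded y in l , <-≤-trans l<y y≤x , l<y

≢⇒<⊎> : ∀ {x y} → x ≢ y → x < y ⊎ y < x
≢⇒<⊎> {x} {y} x≢y with <-cmp x y
... | tri< x<y _ _ = inj₁ x<y
... | tri≈ _ x≡y _ = contradiction x≡y x≢y
... | tri> _ _ y<x = inj₂ y<x

·-mono-< : ∀ g {x y} → x < y → g · x < g · y
·-mono-< g {x} {y} x<y with <-cmp (g · x) (g · y)
... | tri< p _ _ = p
... | tri≈ _ p _ = contradiction x<y (<-irrefl (injective g p))
... | tri> _ _ p = contradiction (≤-<-trans (mono g (<⇒≤ x<y)) p) (<-irrefl refl)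

·-cancel-< : ∀ g {x y} → g · x < g · y → x < y
·-cancel-< g {x} {y} p =
  subst₂ _<_ (inverseʳ g x) (inverseʳ g y) (·-mono-< (g G.⁻¹) p)

fix⁻¹ : ∀ g {x} → g · x ≡ x → g G.⁻¹ · x ≡ x
fix⁻¹ g {x} p = trans (cong (g G.⁻¹ ·_) (sym p)) (inverseʳ g x)

mkAut : (f f⁻ : ℚ → ℚ) → (∀ {x y} → x < y → f x < f y) → (∀ y → f (f⁻ y) ≡ y) → Aut
mkAut f f⁻ f-mono f∘f⁻ = record
  { ⟦_⟧ = f
  ; isOrderIsomorphism = record
    { isOrderMonomorphism = record
      { isOrderHomomorphism = record { cong = cong f ; mono = mono-≤ }
      ; injective = inj
      ; cancel = λ {x} {y} p → ≮⇒≥ λ y<x → <-irrefl refl (<-≤-trans (f-mono y<x) p)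
      }
    ; surjective = λ y → f⁻ y , λ { refl → f∘f⁻ y }
    }
  }
  where
  mono-≤ : ∀ {x y} → x ≤ y → f x ≤ f y
  mono-≤ {x} {y} x≤y with <-cmp x y
  ... | tri< x<y _ _ = <⇒≤ (f-mono x<y)
  ... | tri≈ _ refl _ = ≤-refl
  ... | tri> _ _ y<x = contradiction (≤-<-trans x≤y y<x) (<-irrefl refl)
  inj : ∀ {x y} → f x ≡ f y → x ≡ y
  inj {x} {y} p with <-cmp x y
  ... | tri< x<y _ _ = contradiction (f-mono x<y) (<-irrefl p)
  ... | tri≈ _ x≡y _ = x≡y
  ... | tri> _ _ y<x = contradiction (f-mono y<x) (<-irrefl (sym p))

-- An enumeration of ℚ

nextPair : ℕ × ℕ → ℕ × ℕ
nextPair (zero  , b) = suc b , zero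
nextPair (suc a , b) = a , suc b

pair : ℕ → ℕ × ℕ
pair zero    = zero , zero
pair (suc n) = nextPair (pair n)

pair-surjective : ∀ a b → ∃ λ n → pair n ≡ (a , b)
pair-surjective a b = antidiagonal b (a ℕ.+ b) a refl
  where
  antidiagonal : ∀ b s a → a ℕ.+ b ≡ s → ∃ λ n → pair n ≡ (a , b)
  antidiagonal zero    zero    zero    _    = zero , refl
  antidiagonal zero    (suc s) (suc a) eq   =
    let n , p = antidiagonal s s 0 refl
    in suc n , trans (cong nextPair p) (cong (λ k → suc k , 0)
      (trans (ℕ.suc-injective (sym eq)) (ℕ.+-identityʳ a)))
  antidiagonal (suc b) s a eq =
    let n , p = antidiagonal b s (suc a) (trans (sym (ℕ.+-suc a b)) eq)
    in suc n , cong nextPair p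

fraction : ℕ × ℕ → ℕ → ℚ
fraction (a , b) d = (a ℤ.⊖ b) ℚ./ suc d

enumℚ : ℕ → ℚ
enumℚ n = fraction (pair (proj₁ (pair n))) (proj₂ (pair n))

enumℚ-surjective : ∀ q → ∃ λ n → enumℚ n ≡ q
enumℚ-surjective q =
  let a , b , num   = difference (ℚ.↥ q)
      m , p         = pair-surjective a b
      n , r         = pair-surjective m (ℚ.ℚ.denominator-1 q)
  in n , trans (cong (λ k → fraction (pair (proj₁ k)) (proj₂ k)) r)
    (trans (cong (λ k → fraction k (ℚ.ℚ.denominator-1 q)) p)
      (trans (cong (ℚ._/ ℚ.↧ₙ q) num) (ℚ.↥p/↧p≡p q)))
  where
  difference : ∀ i → ∃₂ λ a b → a ℤ.⊖ b ≡ i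
  difference (+ n)    = n , 0 , refl
  difference -[1+ n ] = 0 , suc n , refl

-- Gluing and iterating automorphisms

-- Named after the side on which `g` may move points: its support lies above, respectively below,
-- `c`.
Above Below : ℚ → Aut → Set
Above c g = ∀ {x} → x ≤ c → g · x ≡ x
Below c g = ∀ {x} → c ≤ x → g · x ≡ x

Disjoint : Aut → Aut → Set
Disjoint f g = ∀ x → f · x ≡ x ⊎ g · x ≡ x

module _ (e : ℚ) (f g : Aut) where

  glueMap : ℚ → ℚ
  glueMap x with x ℚ.<? e
  ... | yes _ = f · x
  ... | no  _ = g · x

  glueMap-< : ∀ {x} → x < e → glueMap x ≡ f · x
  glueMap-< {x} x<e with x ℚ.<? e
  ... | yes _   = refl
  ... | no  x≮e = contradiction x<e x≮e

  glueMap-≥ : ∀ {x} → e ≤ x → glueMap x ≡ g · x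
  glueMap-≥ {x} e≤x with x ℚ.<? e
  ... | yes x<e = contradiction (<-≤-trans x<e e≤x) (<-irrefl refl)
  ... | no  _   = refl

module _ (e : ℚ) (f g : Aut) (fe : f · e ≡ e) (ge : g · e ≡ e) where

  glue : Aut
  glue = mkAut (glueMap e f g) (glueMap e (f G.⁻¹) (g G.⁻¹)) glue-mono glue-inverse
    where
    f-< : ∀ h → h · e ≡ e → ∀ {x} → x < e → h · x < e
    f-< h he {x} x<e = subst (h · x <_) he (·-mono-< h x<e)

    g-≥ : ∀ h → h · e ≡ e → ∀ {x} → e ≤ x → e ≤ h · x
    g-≥ h he {x} e≤x = subst (_≤ h · x) he (mono h e≤x)

    glue-mono : ∀ {x y} → x < y → glueMap e f g x < glueMap e f g y
    glue-mono {x} {y} x<y with x ℚ.<? e | y ℚ.<? e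
    ... | yes _   | yes _   = ·-mono-< f x<y
    ... | yes x<e | no  y≮e = <-≤-trans (f-< f fe x<e) (g-≥ g ge (≮⇒≥ y≮e))
    ... | no  x≮e | yes y<e = contradiction (<-trans x<y y<e) x≮e
    ... | no  _   | no  _   = ·-mono-< g x<y

    glue-inverse : ∀ y → glueMap e f g (glueMap e (f G.⁻¹) (g G.⁻¹) y) ≡ y
    glue-inverse y with y ℚ.<? e
    ... | yes y<e = trans (glueMap-< e f g (f-< (f G.⁻¹) (fix⁻¹ f fe) y<e)) (inverseˡ f y)
    ... | no  y≮e = trans (glueMap-≥ e f g (g-≥ (g G.⁻¹) (fix⁻¹ g ge) (≮⇒≥ y≮e))) (inverseˡ g y)

lowerPart upperPart : ∀ e g → g · e ≡ e → Aut
lowerPart e g ge = glue e g G.ε ge refl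
upperPart e g ge = glue e G.ε g refl ge

lowerPart-Below : ∀ e g ge → Below e (lowerPart e g ge)
lowerPart-Below e g _ = glueMap-≥ e g G.ε

upperPart-Above : ∀ e g ge → Above e (upperPart e g ge)
upperPart-Above e g ge {x} x≤e with <-cmp x e
... | tri< x<e _ _ = glueMap-< e G.ε g x<e
... | tri≈ _ refl _ = trans (glueMap-≥ e G.ε g ≤-refl) ge
... | tri> _ _ e<x = contradiction (≤-<-trans x≤e e<x) (<-irrefl refl)

lower∙upper : ∀ e g ge → lowerPart e g ge G.∙ upperPart e g ge G.≈ g
lower∙upper e g ge x with x ℚ.<? e
... | yes x<e = glueMap-< e g G.ε x<e
... | no  x≮e = glueMap-≥ e g G.ε (subst (_≤ g · x) ge (mono g (≮⇒≥ x≮e)))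

-- Each map preserves its own support: `g · x` is moved by `g` as soon as `x` is. This is why the
-- hypothesis is consulted at `g · x` and `f · x` as well.
disjoint⇒commute : ∀ f g → Disjoint f g → Commute Autℚ f g
disjoint⇒commute f g f⊥g x with f⊥g x | f⊥g (g · x) | f⊥g (f · x)
... | inj₁ fx≡x | inj₁ fgx≡gx | _           = trans fgx≡gx (cong (g ·_) (sym fx≡x))
... | inj₁ fx≡x | inj₂ ggx≡gx | _           =
  let gx≡x = injective g ggx≡gx in trans (cong (f ·_) gx≡x) (trans fx≡x (sym (trans (cong (g ·_) fx≡x) gx≡x)))
... | inj₂ gx≡x | _           | inj₂ gfx≡fx = trans (cong (f ·_) gx≡x) (sym gfx≡fx)
... | inj₂ gx≡x | _           | inj₁ ffx≡fx =
  let fx≡x = injective f ffx≡fx in trans (cong (f ·_) gx≡x) (trans fx≡x (sym (trans (cong (g ·_) fx≡x) gx≡x)))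

commute⁻¹ : ∀ f g → Commute Autℚ f g → Commute Autℚ (f G.⁻¹) g
commute⁻¹ f g fg x = injective f (trans (inverseˡ f (g · x))
  (sym (trans (fg (f G.⁻¹ · x)) (cong (g ·_) (inverseˡ f x)))))

iter : Aut → ℕ → ℚ → ℚ
iter g zero    x = x
iter g (suc n) x = g · iter g n x

iter-+ : ∀ g m n x → iter g (m ℕ.+ n) x ≡ iter g m (iter g n x)
iter-+ g zero    n x = refl
iter-+ g (suc m) n x = cong (g ·_) (iter-+ g m n x)

commute-iter : ∀ f g → Commute Autℚ f g → ∀ n x → f · iter g n x ≡ iter g n (f · x)
commute-iter f g fg zero    x = refl
commute-iter f g fg (suc n) x = trans (fg (iter g n x)) (cong (g ·_) (commute-iter f g fg n x))

In : ℚ → ℚ → ℚ → Set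
In u v x = u < x × x < v

∉⇒fixed : ∀ {u v g} → Above u g → Below v g → ∀ {x} → ¬ In u v x → g · x ≡ x
∉⇒fixed {u} {v} g-above g-below {x} x∉ with u ℚ.<? x
... | no  u≮x = g-above (≮⇒≥ u≮x)
... | yes u<x = g-below (≮⇒≥ λ x<v → x∉ (u<x , x<v))

Wandering : Aut → ℚ → ℚ → Set
Wandering g u v = ∀ n {x} → In u v x → ¬ In u v (iter g (suc n) x)

iter-beyond-> : ∀ g {u} → u < g · u → ∀ n {x} → u < x → g · u < iter g (suc n) x
iter-beyond-> g u<gu zero    u<x = ·-mono-< g u<x
iter-beyond-> g u<gu (suc n) u<x = ·-mono-< g (<-trans u<gu (iter-beyond-> g u<gu n u<x))

iter-beyond-< : ∀ g {v} → g · v < v → ∀ n {x} → x < v → iter g (suc n) x < g · v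
iter-beyond-< g gv<v zero    x<v = ·-mono-< g x<v
iter-beyond-< g gv<v (suc n) x<v = ·-mono-< g (<-trans (iter-beyond-< g gv<v n x<v) gv<v)

abstract
  -- If g raises y, the interval is (u, g u) with u between g⁻¹ y and y: it contains y, and g
  -- carries it past its right end, where all later iterates stay. The other case is the mirror
  -- image.
  wandering : ∀ g {y} → g · y ≢ y → ∃₂ λ u v → In u v y × Wandering g u v
  wandering g {y} gy≢y with ≢⇒<⊎> gy≢y
  ... | inj₂ y<gy =
    let u , g⁻¹y<u , u<y = dense (·-cancel-< g (subst (_< g · y) (sym (inverseˡ g y)) y<gy))
        y<gu = subst (_< g · u) (inverseˡ g y) (·-mono-< g g⁻¹y<u)
    in u , g · u , (u<y , y<gu) , λ n (u<x , _) (_ , gx<gu) →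
      <-asym gx<gu (iter-beyond-> g (<-trans u<y y<gu) n u<x)
  ... | inj₁ gy<y =
    let v , y<v , v<g⁻¹y = dense (·-cancel-< g (subst (g · y <_) (sym (inverseˡ g y)) gy<y))
        gv<y = subst (g · v <_) (inverseˡ g y) (·-mono-< g v<g⁻¹y)
    in g · v , v , (gv<y , y<v) , λ n (_ , x<v) (gv<gx , _) →
      <-asym gv<gx (iter-beyond-< g (<-trans gv<y y<v) n x<v)

In-mono : ∀ {u v u′ v′ x} → u′ ≤ u → v ≤ v′ → In u v x → In u′ v′ x
In-mono u′≤u v≤v′ (u<x , x<v) = ≤-<-trans u′≤u u<x , <-≤-trans x<v v≤v′

abstract
  In-∩ : ∀ {u v u′ v′ y} → In u v y → In u′ v′ y →
    ∃₂ λ l r → In l r y × (∀ {x} → In l r x → In u v x × In u′ v′ x)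
  In-∩ {u} {v} {u′} {v′} (u<y , y<v) (u′<y , y<v′) with ≤-total u u′ | ≤-total v v′
  ... | inj₁ p | inj₁ q = u′ , v  , (u′<y , y<v)  , λ i → In-mono p ≤-refl i , In-mono ≤-refl q i
  ... | inj₁ p | inj₂ q = u′ , v′ , (u′<y , y<v′) , λ i → In-mono p q i , i
  ... | inj₂ p | inj₁ q = u  , v  , (u<y , y<v)   , λ i → i , In-mono p q i
  ... | inj₂ p | inj₂ q = u  , v′ , (u<y , y<v′)  , λ i → In-mono ≤-refl q i , In-mono p ≤-refl i

-- Signed order automorphisms, as permutations of ℚ

private
  module Γ = Group (GroupAut Autℚ)
  module S = Group (SemidirectProduct Autℚ ℤ₂ negAction)

sign : Parity → ℚ → ℚ
sign 0ℙ x = x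
sign 1ℙ x = - x

sign-involutive : ∀ h x → sign h (sign h x) ≡ x
sign-involutive 0ℙ = λ _ → refl
sign-involutive 1ℙ = neg-involutive

σ σ⁻ : S.Carrier → ℚ → ℚ
σ  (f , h) x = f · sign h x
σ⁻ (f , h) y = sign h (f G.⁻¹ · y)

σ-σ⁻ : ∀ p y → σ p (σ⁻ p y) ≡ y
σ-σ⁻ (f , h) y = trans (cong (f ·_) (sign-involutive h _)) (inverseˡ f y)

σ⁻-σ : ∀ p x → σ⁻ p (σ p x) ≡ x
σ⁻-σ (f , h) x = trans (cong (sign h) (inverseʳ f _)) (sign-involutive h x)

σ-injective : ∀ p {x y} → σ p x ≡ σ p y → x ≡ y
σ-injective p {x} {y} e = trans (sym (σ⁻-σ p x)) (trans (cong (σ⁻ p) e) (σ⁻-σ p y))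

σ-∙ : ∀ p q x → σ (p S.∙ q) x ≡ σ p (σ q x)
σ-∙ (f , 0ℙ) (f′ , h′) x = refl
σ-∙ (f , 1ℙ) (f′ , 0ℙ) x = cong (λ y → f · - (f′ · y)) (neg-involutive x)
σ-∙ (f , 1ℙ) (f′ , 1ℙ) x = refl

σ-cong : ∀ p q → p S.≈ q → ∀ x → σ p x ≡ σ q x
σ-cong (f , h) (f′ , .h) (f≈f′ , refl) x = f≈f′ (sign h x)

parity-unique : ∀ {f f′ h h′} → (∀ x → σ (f , h) x ≡ σ (f′ , h′) x) → h ≡ h′
parity-unique {h = 0ℙ} {0ℙ} _ = refl
parity-unique {h = 1ℙ} {1ℙ} _ = refl
parity-unique {f} {f′} {0ℙ} {1ℙ} e = contradiction (·-mono-< f (x<x+1 0ℚ))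
  (<-asym (subst₂ _<_ (sym (e (0ℚ ℚ.+ 1ℚ))) (sym (e 0ℚ)) (·-mono-< f′ (ℚ.neg-antimono-< (x<x+1 0ℚ)))))
parity-unique {f} {f′} {1ℙ} {0ℙ} e = contradiction (·-mono-< f′ (x<x+1 0ℚ))
  (<-asym (subst₂ _<_ (e (0ℚ ℚ.+ 1ℚ)) (e 0ℚ) (·-mono-< f (ℚ.neg-antimono-< (x<x+1 0ℚ)))))

σ-faithful : ∀ p q → (∀ x → σ p x ≡ σ q x) → p S.≈ q
σ-faithful p@(f , h) q@(f′ , h′) e = f≈f′ , parity-unique {f} {f′} {h} {h′} e
  where
  f≈f′ : f G.≈ f′
  f≈f′ y with parity-unique {f} {f′} {h} {h′} e
  ... | refl = subst (λ x → f · x ≡ f′ · x) (sign-involutive h y) (e (sign h y))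

-- This is conjugation by the permutation `σ p`, written without its inverse. As a relation it is
-- the isomorphism to be built: up to ≈, each side turns out to determine the other.
Induces : S.Carrier → Γ.Carrier → Set
Induces p φ = ∀ g x → _≅_.⟦_⟧ φ g · σ p x ≡ σ p (g · x)

induced-unique : ∀ p q φ χ → Induces p φ → Induces q χ → p S.≈ q → φ Γ.≈ χ
induced-unique p q φ χ p↝φ q↝χ p≈q g y = subst (λ y → _≅_.⟦_⟧ φ g · y ≡ _≅_.⟦_⟧ χ g · y) (σ-σ⁻ p y)
  (trans (p↝φ g (σ⁻ p y)) (trans (σ-cong p q p≈q (g · σ⁻ p y)) (trans (sym (q↝χ g (σ⁻ p y)))
    (cong (_≅_.⟦_⟧ χ g ·_) (sym (σ-cong p q p≈q (σ⁻ p y)))))))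

Induces-∙ : ∀ p q φ χ → Induces p φ → Induces q χ → Induces (p S.∙ q) (φ Γ.∙ χ)
Induces-∙ p q φ χ p↝φ q↝χ g x =
  trans (cong (_≅_.⟦_⟧ φ (_≅_.⟦_⟧ χ g) ·_) (σ-∙ p q x)) (trans (p↝φ (_≅_.⟦_⟧ χ g) (σ q x))
    (trans (cong (σ p) (q↝χ g x)) (sym (σ-∙ p q (g · x)))))

Induces-⁻¹ : ∀ p φ → Induces p φ → Induces (p S.⁻¹) (φ Γ.⁻¹)
Induces-⁻¹ p φ p↝φ g x = σ-injective p (trans (sym (p↝φ ψg _))
  (trans (cong (_≅_.⟦_⟧ φ ψg ·_) (σ-σ p x)) (trans (_≅_.inverseˡ φ g x) (sym (σ-σ p (g · x))))))
  where
  ψg = _≅_.inv φ g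
  σ-σ : ∀ p x → σ p (σ (p S.⁻¹) x) ≡ x
  σ-σ p x = trans (sym (σ-∙ p (p S.⁻¹) x)) (σ-cong (p S.∙ p S.⁻¹) S.ε (S.inverseʳ p) x)

inner : Aut → Autℚ ≅ Autℚ
inner f = record
  { ⟦_⟧ = λ g → f G.∙ (g G.∙ f G.⁻¹)
  ; isGroupIsomorphism = record
    { isGroupMonomorphism = record
      { isGroupHomomorphism = record
        { isMonoidHomomorphism = record
          { isMagmaHomomorphism = record
            { isRelHomomorphism = record { cong = λ p x → cong (f ·_) (p (f G.⁻¹ · x)) }
            ; homo = λ g g′ x → cong (λ y → f · g · y) (sym (inverseʳ f (g′ · f G.⁻¹ · x)))
            }
          ; ε-homo = inverseˡ f
          }
        ; ⁻¹-homo = λ g x → refl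
        }
      ; injective = λ {g} {g′} p x → injective f
          (subst (λ y → f · g · y ≡ f · g′ · y) (inverseʳ f x) (p (f · x)))
      }
    ; surjective = λ g → f G.⁻¹ G.∙ (g G.∙ f) , λ p x → trans (cong (f ·_) (p (f G.⁻¹ · x)))
        (trans (inverseˡ f _) (cong (g ·_) (inverseˡ f x)))
    }
  }

induced : ∀ p → ∃ (Induces p)
induced (f , h) = inner f Γ.∙ act h , λ g x → cong (f ·_)
  (trans (cong (_≅_.⟦_⟧ (act h) g ·_) (inverseʳ f (sign h x))) (act-sign h g x))
  where
  act : Parity → Autℚ ≅ Autℚ
  act = GroupHomomorphism.⟦_⟧ negAction
  act-sign : ∀ h g x → _≅_.⟦_⟧ (act h) g · sign h x ≡ sign h (g · x)
  act-sign 0ℙ g x = refl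
  act-sign 1ℙ g x = cong (λ y → - (g · y)) (neg-involutive x)

-- Back-and-forth

_≺_ : ℚ × ℚ → ℚ × ℚ → Set
(a , b) ≺ (a′ , b′) = a < a′ × b < b′

_∼_ : ℚ × ℚ → ℚ × ℚ → Set
p ∼ q = p ≡ q ⊎ p ≺ q ⊎ q ≺ p

∼-sym : ∀ {p q} → p ∼ q → q ∼ p
∼-sym (inj₁ refl)     = inj₁ refl
∼-sym (inj₂ (inj₁ r)) = inj₂ (inj₂ r)
∼-sym (inj₂ (inj₂ r)) = inj₂ (inj₁ r)

∼-flip : ∀ {p q} → p ∼ q → swap p ∼ swap q
∼-flip (inj₁ refl)           = inj₁ refl
∼-flip (inj₂ (inj₁ (r , s))) = inj₂ (inj₁ (s , r))
∼-flip (inj₂ (inj₂ (r , s))) = inj₂ (inj₂ (s , r))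

∼-mono : ∀ {a b a′ b′} → (a , b) ∼ (a′ , b′) → a < a′ → b < b′
∼-mono (inj₁ refl)           p = contradiction p (<-irrefl refl)
∼-mono (inj₂ (inj₁ (_ , s))) _ = s
∼-mono (inj₂ (inj₂ (r , _))) p = contradiction p (<-asym r)

∼-functional : ∀ {a b b′} → (a , b) ∼ (a , b′) → b ≡ b′
∼-functional (inj₁ refl)           = refl
∼-functional (inj₂ (inj₁ (r , _))) = contradiction r (<-irrefl refl)
∼-functional (inj₂ (inj₂ (r , _))) = contradiction r (<-irrefl refl)

PartialIso : Set
PartialIso = Σ (List (ℚ × ℚ)) (AllPairs _∼_)

coherent : ∀ {L} → AllPairs _∼_ L → ∀ {p q} → p ∈ L → q ∈ L → p ∼ q
coherent (_ ∷ _)  (here refl) (here refl) = inj₁ refl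
coherent (r ∷ _)  (here refl) (there j)   = All.lookup r j
coherent (r ∷ _)  (there i)   (here refl) = ∼-sym (All.lookup r i)
coherent (_ ∷ rs) (there i)   (there j)   = coherent rs i j

_⊑_ : PartialIso → PartialIso → Set
C ⊑ C′ = proj₁ C ⊆ proj₁ C′

flip-coherent : ∀ {L} → AllPairs _∼_ L → AllPairs _∼_ (List.map swap L)
flip-coherent coh = AllPairs.map⁺ (AllPairs.map ∼-flip coh)

Agrees : Aut → PartialIso → Set
Agrees g C = ∀ {x y} → (x , y) ∈ proj₁ C → g · x ≡ y

-- If this holds for all `C`, then `R` is dense in the sense of forcing with finite partial
-- isomorphisms; `back-and-forth` produces an automorphism generic for countably many such sets.
Meets : (ℚ × ℚ → Set) → PartialIso → Set
Meets R C = Σ PartialIso λ C′ → C ⊑ C′ × ∃ λ p → p ∈ proj₁ C′ × R p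

module _ (em : ExcludedMiddle 0ℓ) where

  by-contradiction : {P : Set} → ¬ ¬ P → P
  by-contradiction {P} ¬¬p with em {P}
  ... | yes p = p
  ... | no ¬p = contradiction ¬p ¬¬p

  ¬∀⇒∃¬ : {A : Set} {P : A → Set} → ¬ (∀ x → P x) → ∃ λ x → ¬ P x
  ¬∀⇒∃¬ ¬∀ = by-contradiction λ ¬∃ → ¬∀ λ x → by-contradiction λ ¬Px → ¬∃ (x , ¬Px)

  module _ (f : ℚ × ℚ → ℚ) where

    strictly-below : (Q : ℚ × ℚ → Set) (b : ℚ) (L : List (ℚ × ℚ)) →
      (∀ {q} → q ∈ L → Q q → b < f q) →
      ∃ λ y → b < y × (∀ {q} → q ∈ L → Q q → y < f q)
    strictly-below Q b []      _     = let y , b<y = <-unbounded b in y , b<y , λ ()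
    strictly-below Q b (p ∷ L) b<L with strictly-below Q b L (b<L ∘ there) | em {Q p}
    ... | y , b<y , y<L | no ¬Qp = y , b<y ,
      λ { (here refl) Qp → contradiction Qp ¬Qp ; (there i) → y<L i }
    ... | y , b<y , y<L | yes Qp with ≤-total y (f p)
    ...   | inj₁ y≤p = let m , b<m , m<y = dense b<y in m , b<m ,
      λ { (here refl) _ → <-≤-trans m<y y≤p ; (there i) Qq → <-trans m<y (y<L i Qq) }
    ...   | inj₂ p≤y = let m , b<m , m<p = dense (b<L (here refl) Qp) in m , b<m ,
      λ { (here refl) _ → m<p ; (there i) Qq → <-trans m<p (≤-<-trans p≤y (y<L i Qq)) }

    lower-bound : ∀ L → ∃ λ y → ∀ {q} → q ∈ L → y < f q
    lower-bound []      = 0ℚ , λ ()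
    lower-bound (p ∷ L) =
      let y , y<L       = lower-bound L
          l , l<p , l<y = common-lower (f p) y
      in l , λ { (here refl) → l<p ; (there i) → <-trans l<y (y<L i) }

    -- Density of ℚ for finite sets: `y` is raised past the relevant elements of `L` one at a time,
    -- and `strictly-below` keeps it under those of `M`.
    interpolate : (P Q : ℚ × ℚ → Set) (L M : List (ℚ × ℚ)) →
      (∀ {p q} → p ∈ L → q ∈ M → P p → Q q → f p < f q) →
      ∃ λ y → (∀ {p} → p ∈ L → P p → f p < y) × (∀ {q} → q ∈ M → Q q → y < f q)
    interpolate P Q []      M _   =
      let y , y<M = lower-bound M in y , (λ ()) , λ i _ → y<M i
    interpolate P Q (r ∷ L) M L<M with interpolate P Q L M (L<M ∘ there) | em {P r}
    ... | y , L<y , y<M | no ¬Pr =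
      y , (λ { (here refl) Pr → contradiction Pr ¬Pr ; (there i) → L<y i }) , y<M
    ... | y , L<y , y<M | yes Pr with ≤-total y (f r)
    ...   | inj₁ y≤r =
      let z , r<z , z<M = strictly-below Q (f r) M (λ j Qq → L<M (here refl) j Pr Qq)
      in z , (λ { (here refl) _ → r<z ; (there i) Pp → <-trans (L<y i Pp) (≤-<-trans y≤r r<z) }) , z<M
    ...   | inj₂ r≤y =
      let z , y<z , z<M = strictly-below Q y M y<M
      in z , (λ { (here refl) _ → ≤-<-trans r≤y y<z ; (there i) Pp → <-trans (L<y i Pp) y<z }) , z<M

  extend-domain : ∀ C x → Σ PartialIso λ C′ → C ⊑ C′ × ∃ λ y → (x , y) ∈ proj₁ C′
  extend-domain C@(L , coh) x with em {∃ λ y → (x , y) ∈ L}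
  ... | yes (y , i) = C , id , y , i
  ... | no  x∉L     =
    let y , L<y , y<L = interpolate proj₂ (λ p → proj₁ p < x) (λ q → x < proj₁ q) L L
          (λ i j a<x x<a′ → ∼-mono (coherent coh i j) (<-trans a<x x<a′))
        new : ∀ {p} → p ∈ L → (x , y) ∼ p
        new {a , b} i = [ (λ x<a → inj₂ (inj₁ (x<a , y<L i x<a)))
                        , (λ a<x → inj₂ (inj₂ (a<x , L<y i a<x))) ]′
                        (≢⇒<⊎> λ { refl → x∉L (b , i) })
    in ((x , y) ∷ L , All.tabulate new ∷ coh) , there , y , here refl

  extend-range : ∀ C y → Σ PartialIso λ C′ → C ⊑ C′ × ∃ λ x → (x , y) ∈ proj₁ C′
  extend-range (L , coh) y =
    let (M , coh′) , L⊆M , x , i = extend-domain (List.map swap L , flip-coherent coh) y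
    in (List.map swap M , flip-coherent coh′) , ∈-map⁺ swap ∘ L⊆M ∘ ∈-map⁺ swap , x , ∈-map⁺ swap i

  abstract
    back-and-forth : (C₀ : PartialIso) (R : ℕ → ℚ × ℚ → Set) → (∀ n C → Meets (R n) C) →
      ∃ λ g → Agrees g C₀ × (∀ n → ∃ λ x → R n (x , g · x))
    back-and-forth C₀ R meet = g , (λ i → g-graph (0 , i)) , λ n →
      let (x , y) , i , r = proj₂ (proj₂ (meet n (stage n)))
      in x , subst (λ y → R n (x , y)) (sym (g-graph (suc n , range-⊑ n (domain-⊑ n i)))) r
      where
      after-domain : ℕ → PartialIso → PartialIso
      after-domain n C = proj₁ (extend-domain (proj₁ (meet n C)) (enumℚ n))

      stage : ℕ → PartialIso
      stage zero    = C₀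
      stage (suc n) = proj₁ (extend-range (after-domain n (stage n)) (enumℚ n))

      domain-⊑ : ∀ n → proj₁ (meet n (stage n)) ⊑ after-domain n (stage n)
      domain-⊑ n = proj₁ (proj₂ (extend-domain (proj₁ (meet n (stage n))) (enumℚ n)))

      range-⊑ : ∀ n → after-domain n (stage n) ⊑ stage (suc n)
      range-⊑ n = proj₁ (proj₂ (extend-range (after-domain n (stage n)) (enumℚ n)))

      Graph : ℚ × ℚ → Set
      Graph p = ∃ λ n → p ∈ proj₁ (stage n)

      stage-⊑ : ∀ m n → stage n ⊑ stage (m ℕ.+ n)
      stage-⊑ zero    n = id
      stage-⊑ (suc m) n i =
        range-⊑ (m ℕ.+ n) (domain-⊑ (m ℕ.+ n) (proj₁ (proj₂ (meet (m ℕ.+ n) (stage (m ℕ.+ n)))) (stage-⊑ m n i)))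

      graph-coherent : ∀ {p q} → Graph p → Graph q → p ∼ q
      graph-coherent {q = q} (m , i) (n , j) = coherent (proj₂ (stage (n ℕ.+ m))) (stage-⊑ n m i)
        (subst (λ k → q ∈ proj₁ (stage k)) (ℕ.+-comm m n) (stage-⊑ m n j))

      defined : ∀ x → ∃ λ y → Graph (x , y)
      defined x with enumℚ-surjective x
      ... | n , refl =
        let y , i = proj₂ (proj₂ (extend-domain (proj₁ (meet n (stage n))) (enumℚ n)))
        in y , suc n , range-⊑ n i

      attained : ∀ y → ∃ λ x → Graph (x , y)
      attained y with enumℚ-surjective y
      ... | n , refl =
        let x , i = proj₂ (proj₂ (extend-range (after-domain n (stage n)) (enumℚ n)))
        in x , suc n , i

      g : Aut
      g = mkAut (proj₁ ∘ defined) (proj₁ ∘ attained)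
        (λ {x} {y} → ∼-mono (graph-coherent (proj₂ (defined x)) (proj₂ (defined y))))
        (λ y → ∼-functional (graph-coherent (proj₂ (defined (proj₁ (attained y)))) (proj₂ (attained y))))

      g-graph : ∀ {x y} → Graph (x , y) → g · x ≡ y
      g-graph {x} i = ∼-functional (graph-coherent (proj₂ (defined x)) i)

  abstract
    extend-partialIso : ∀ C → ∃ λ g → Agrees g C
    extend-partialIso C = map₂ proj₁ (back-and-forth C (λ _ _ → ⊤) λ _ C →
      -- Even the trivial requirement must be met by some pair, so a dummy point 0 is put into the
      -- domain.
      let C′ , C⊑C′ , _ , i = extend-domain C 0ℚ in C′ , C⊑C′ , _ , i , tt)

  abstract
    move₂ : ∀ {c d u v} → c < d → u < v → ∃ λ g → g · c ≡ u × g · d ≡ v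
    move₂ {c} {d} {u} {v} c<d u<v =
      let g , agrees = extend-partialIso ((c , u) ∷ (d , v) ∷ [] ,
            (inj₂ (inj₁ (c<d , u<v)) ∷ []) ∷ [] ∷ [])
      in g , agrees (here refl) , agrees (there (here refl))

    bump : ∀ {u v x y} → In u v x → In u v y → ∃ λ g → Above u g × Below v g × g · x ≡ y
    bump {u} {v} {x} {y} (u<x , x<v) (u<y , y<v) =
      let f , agrees = extend-partialIso ((u , u) ∷ (x , y) ∷ (v , v) ∷ [] ,
            (inj₂ (inj₁ (u<x , u<y)) ∷ inj₂ (inj₁ (<-trans u<x x<v , <-trans u<x x<v)) ∷ []) ∷
            (inj₂ (inj₁ (x<v , y<v)) ∷ []) ∷ [] ∷ [])
          fu = agrees (here refl)
          fv = agrees (there (there (here refl)))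
          h  = upperPart u f fu
          hv = trans (glueMap-≥ u G.ε f (<⇒≤ (<-trans u<x x<v))) fv
      in lowerPart v h hv
       , (λ z≤u → trans (glueMap-< v h G.ε (≤-<-trans z≤u (<-trans u<x x<v))) (upperPart-Above u f fu z≤u))
       , lowerPart-Below v h hv
       , trans (glueMap-< v h G.ε x<v) (trans (glueMap-≥ u G.ε f (<⇒≤ u<x)) (agrees (there (here refl))))

  -- Algebraic disjointness is disjointness of supports

  -- One of x, f x, h x will do, where x is a point at which fh and hf differ: if only f moves x,
  -- then h must move f x, and symmetrically.
  both-moved : ∀ f h → ¬ Commute Autℚ f h → ∃ λ y → f · y ≢ y × h · y ≢ y
  both-moved f h ¬fh with ¬∀⇒∃¬ ¬fh
  ... | x , fhx≢hfx with em {f · x ≡ x} | em {h · x ≡ x}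
  ...   | no fx≢x  | no hx≢x  = x , fx≢x , hx≢x
  ...   | no fx≢x  | yes hx≡x = f · x , (fx≢x ∘ injective f) ,
    λ hfx≡fx → fhx≢hfx (trans (cong (f ·_) hx≡x) (sym hfx≡fx))
  ...   | yes fx≡x | no hx≢x  = h · x ,
    (λ fhx≡hx → fhx≢hfx (trans fhx≡hx (cong (h ·_) (sym fx≡x)))) , (hx≢x ∘ injective h)
  ...   | yes fx≡x | yes hx≡x = contradiction
    (trans (cong (f ·_) hx≡x) (trans fx≡x (sym (trans (cong (h ·_) fx≡x) hx≡x)))) fhx≢hfx

  off⇒disjoint : ∀ {u v} c g → (∀ {x} → ¬ In u v x → c · x ≡ x) →
    (∀ {x} → In u v x → g · x ≡ x) → Disjoint c g
  off⇒disjoint {u} {v} c g c-off g-fixes x with em {In u v x}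
  ... | no x∉  = inj₁ (c-off x∉)
  ... | yes x∈ = inj₂ (g-fixes x∈)

  -- If (u,v) is disjoint from its image under h and a, b are supported in (u,v), then
  -- m = h b⁻¹ h⁻¹ commutes with a, hence [a,[b,h]] = [a,bm] = [a,b].
  module _ {u v} (a b h : Aut)
    (a-off : ∀ {x} → ¬ In u v x → a · x ≡ x) (b-off : ∀ {x} → ¬ In u v x → b · x ≡ x)
    (h-away : ∀ {x} → In u v x → ¬ In u v (h · x)) where

    private
      B m : Aut
      B = commutator Autℚ b h
      m = h G.∙ (b G.⁻¹ G.∙ h G.⁻¹)

    m-fixes : ∀ {x} → In u v x → m · x ≡ x
    m-fixes {x} x∈ = trans (cong (h ·_) (fix⁻¹ b (b-off λ h⁻¹x∈ →
      h-away h⁻¹x∈ (subst (In u v) (sym (inverseˡ h x)) x∈)))) (inverseˡ h x)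

    commutator-fixes : ∀ {x} → a · x ≡ x → b · x ≡ x → commutator Autℚ a B · x ≡ x
    commutator-fixes {x} ax≡x bx≡x =
      trans (cong (λ t → a · b · t) (sym (commute⁻¹ a m a∙m≈m∙a (B G.⁻¹ · x))))
        (trans (cong (λ t → a · b · a G.⁻¹ · t) mB⁻¹x≡x)
          (trans (cong (λ t → a · b · t) (fix⁻¹ a ax≡x)) (trans (cong (a ·_) bx≡x) ax≡x)))
      where
      a∙m≈m∙a : Commute Autℚ a m
      a∙m≈m∙a = disjoint⇒commute a m (off⇒disjoint a m a-off m-fixes)
      mB⁻¹x≡x : m · B G.⁻¹ · x ≡ x
      mB⁻¹x≡x = injective b (trans (inverseˡ B x) (sym bx≡x))

    commutator-disjoint : ∀ g → Disjoint a g → Disjoint b g → Disjoint (commutator Autℚ a B) g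
    commutator-disjoint g a⊥g b⊥g x with a⊥g x | b⊥g x
    ... | inj₂ gx≡x | _         = inj₂ gx≡x
    ... | inj₁ _    | inj₂ gx≡x = inj₂ gx≡x
    ... | inj₁ ax≡x | inj₁ bx≡x = inj₁ (commutator-fixes ax≡x bx≡x)

    -- `B` agrees with `b` on (u,v), as `m` is the identity there. So if the commutator were
    -- trivial, `a` and `B` would commute, and at `y` this reads y₁ = a b y = b a y = y₂.
    commutator-nontrivial : ∀ {y y₁ y₂} → In u v y → In u v y₁ → y₁ ≢ y₂ →
      a · y ≡ y₁ → b · y ≡ y → b · y₁ ≡ y₂ → ¬ commutator Autℚ a B G.≈ G.ε
    commutator-nontrivial {y} y∈ y₁∈ y₁≢y₂ ay≡y₁ by≡y by₁≡y₂ k≈ε = y₁≢y₂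
      (trans (sym (trans (cong (λ t → a · b · t) (m-fixes y∈)) (trans (cong (a ·_) by≡y) ay≡y₁)))
        (trans aB≡Ba (trans (cong (B ·_) ay≡y₁) (trans (cong (b ·_) (m-fixes y₁∈)) by₁≡y₂))))
      where
      aB≡Ba : a · B · y ≡ B · a · y
      aB≡Ba = trans (cong (λ t → a · B · t) (sym (trans
        (cong (a G.⁻¹ ·_) (inverseʳ B (a · y))) (inverseʳ a y)))) (k≈ε (B · a · y))

  -- Around a point moved by both f and h there is an interval that h carries off itself and on
  -- which f moves every point. Then g is the identity on it, so it commutes with any a and b
  -- supported there.
  disjoint⇒algDisjoint : ∀ f g → Disjoint f g → AlgDisjoint Autℚ f g
  disjoint⇒algDisjoint f g f⊥g h ¬fh =
    let y , fy≢y , hy≢y = both-moved f h ¬fh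
        _ , _ , y∈f , f-wanders = wandering f fy≢y
        _ , _ , y∈h , h-wanders = wandering h hy≢y
        u , v , y∈ , sub = In-∩ y∈f y∈h
    in localised y∈
      (λ x∈ hx∈ → h-wanders 0 (proj₂ (sub x∈)) (proj₂ (sub hx∈)))
      (λ x∈ fx≡x → f-wanders 0 (proj₁ (sub x∈)) (subst (In _ _) (sym fx≡x) (proj₁ (sub x∈))))
    where
    localised : ∀ {u v y} → In u v y → (∀ {x} → In u v x → ¬ In u v (h · x)) →
      (∀ {x} → In u v x → f · x ≢ x) → ∃₂ λ a b → Commute Autℚ a g × Commute Autℚ b g ×
        Commute Autℚ (commutator Autℚ a (commutator Autℚ b h)) g ×
        ¬ commutator Autℚ a (commutator Autℚ b h) G.≈ G.ε
    localised {u} {v} {y} y∈@(u<y , y<v) h-away f-moves =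
      let y₁ , y<y₁ , y₁<v = dense y<v
          y₂ , y₁<y₂ , y₂<v = dense y₁<v
          y₁∈ = <-trans u<y y<y₁ , y₁<v
          a , a-above , a-below , ay≡y₁ = bump y∈ y₁∈
          -- The support of `b` starts at `y`, so that `b` fixes `y` but moves `y₁ = a · y`.
          b , b-above , b-below , by₁≡y₂ = bump {y} {v} (y<y₁ , y₁<v) (<-trans y<y₁ y₁<y₂ , y₂<v)
          a-off = ∉⇒fixed {g = a} a-above a-below
          b-off = λ {x} x∉ → ∉⇒fixed {g = b} b-above b-below {x} λ (y<x , x<v) → x∉ (<-trans u<y y<x , x<v)
          a⊥g = off⇒disjoint a g a-off g-fixes
          b⊥g = off⇒disjoint b g b-off g-fixes
          k⊥g = commutator-disjoint a b h a-off b-off h-away g a⊥g b⊥g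
      in a , b , disjoint⇒commute a g a⊥g , disjoint⇒commute b g b⊥g
        , disjoint⇒commute (commutator Autℚ a (commutator Autℚ b h)) g k⊥g
        , commutator-nontrivial a b h a-off b-off h-away y∈ y₁∈
            (λ y₁≡y₂ → <-irrefl y₁≡y₂ y₁<y₂) ay≡y₁ (b-above ≤-refl) by₁≡y₂
      where
      g-fixes : ∀ {x} → In u v x → g · x ≡ x
      g-fixes {x} x∈ with f⊥g x
      ... | inj₁ fx≡x = contradiction fx≡x (f-moves x∈)
      ... | inj₂ gx≡x = gx≡x

  module _ {u v} (a b h : Aut) (h-off : ∀ {x} → ¬ In u v x → h · x ≡ x) where

    private
      B k : Aut
      B = commutator Autℚ b h
      k = commutator Autℚ a B

    translate⁻¹ : Fin 4 → Aut
    translate⁻¹ 0F = G.ε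
    translate⁻¹ 1F = a G.⁻¹
    translate⁻¹ 2F = b G.⁻¹
    translate⁻¹ 3F = b G.⁻¹ G.∙ a G.⁻¹

    B-off : ∀ {x} → ¬ In u v x → ¬ In u v (b G.⁻¹ · x) → B · x ≡ x
    B-off {x} x∉ b⁻¹x∉ = trans (cong (λ t → b · h · b G.⁻¹ · t) (fix⁻¹ h (h-off x∉)))
      (trans (cong (b ·_) (h-off b⁻¹x∉)) (inverseˡ b x))

    commutator-support : ∀ {x} → k · x ≢ x → ∃ λ i → In u v (translate⁻¹ i · x)
    commutator-support {x} kx≢x = by-contradiction λ none → kx≢x
      (trans (cong (λ t → a · B · a G.⁻¹ · t) (fix⁻¹ B (B-off (λ i → none (0F , i)) (λ i → none (2F , i)))))
        (trans (cong (a ·_) (B-off (λ i → none (1F , i)) (λ i → none (3F , i)))) (inverseˡ a x)))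

    translate⁻¹-commute : ∀ {g} → Commute Autℚ a g → Commute Autℚ b g → ∀ i → Commute Autℚ (translate⁻¹ i) g
    translate⁻¹-commute {g} ag bg 0F x = refl
    translate⁻¹-commute {g} ag bg 1F   = commute⁻¹ a g ag
    translate⁻¹-commute {g} ag bg 2F   = commute⁻¹ b g bg
    translate⁻¹-commute {g} ag bg 3F x =
      trans (cong (b G.⁻¹ ·_) (commute⁻¹ a g ag x)) (commute⁻¹ b g bg (a G.⁻¹ · x))

    -- The support of [a,[b,h]] lies in the union of the translates of (u,v) by 1, a, b
    -- and ab, and an orbit of g meets each of them at most once.
    commutator-trivial : ∀ g → Wandering g u v → Commute Autℚ a g → Commute Autℚ b g →
      Commute Autℚ k g → k G.≈ G.ε
    commutator-trivial g wanders ag bg kg z = by-contradiction (orbit z)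
      where
      -- As `k` commutes with `g`, its support is a union of orbits of `g`.
      moved : ∀ {z} → k · z ≢ z → ∀ n → k · iter g n z ≢ iter g n z
      moved kz≢z zero      = kz≢z
      moved kz≢z (suc n) p = moved kz≢z n (injective g (trans (sym (kg _)) p))

      once : ∀ z {m n} → m ℕ.< n → ∀ l → In u v (translate⁻¹ l · iter g m z) →
        ¬ In u v (translate⁻¹ l · iter g n z)
      once z {m} {n} m<n l p q with ℕ.m≤n⇒∃[o]m+o≡n m<n
      ... | o , refl = wanders o (subst (In u v) (commutes m) p)
        (subst (In u v) (trans (commutes (suc m ℕ.+ o)) (trans
          (cong (λ i → iter g (suc i) (translate⁻¹ l · z)) (ℕ.+-comm m o))
          (iter-+ g (suc o) m (translate⁻¹ l · z)))) q)
        where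
        commutes : ∀ i → translate⁻¹ l · iter g i z ≡ iter g i (translate⁻¹ l · z)
        commutes i = commute-iter (translate⁻¹ l) g (translate⁻¹-commute {g} ag bg l) i z

      orbit : ∀ z → ¬ (k · z ≢ z)
      orbit z kz≢z =
        let place = λ (i : Fin 5) → commutator-support (moved kz≢z (toℕ i))
            i , j , i<j , same = pigeonhole ℕ.≤-refl (proj₁ ∘ place)
        in once z i<j (proj₁ (place i)) (proj₂ (place i))
          (subst (λ l → In u v (translate⁻¹ l · iter g (toℕ j) z)) (sym same) (proj₂ (place j)))

  -- If both maps moved y, a small interval around y would wander under g and avoid f y. An h
  -- supported in it and moving y does not commute with f, yet every commutator that the definition
  -- offers for h is trivial by `commutator-trivial`.
  algDisjoint⇒disjoint : ∀ f g → AlgDisjoint Autℚ f g → Disjoint f g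
  algDisjoint⇒disjoint f g f⊥g y with em {f · y ≡ y} | em {g · y ≡ y}
  ... | yes fy≡y | _        = inj₁ fy≡y
  ... | no _     | yes gy≡y = inj₂ gy≡y
  ... | no fy≢y  | no gy≢y  =
    let u , v , y∈ , wanders = wandering g gy≢y
        l , r , avoids-fy , y∈lr = avoid
        u′ , v′ , y∈′@(u′<y , y<v′) , sub = In-∩ y∈ y∈lr
    in ⊥-elim (impossible y∈′ (λ fy∈ → avoids-fy (proj₂ (sub fy∈)))
      λ n i j → wanders n (proj₁ (sub i)) (proj₁ (sub j)))
    where
    avoid : ∃₂ λ l r → ¬ In l r (f · y) × In l r y
    avoid with ≢⇒<⊎> fy≢y
    ... | inj₁ fy<y = let r , y<r = <-unbounded y in f · y , r , (λ i → <-irrefl refl (proj₁ i)) , fy<y , y<r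
    ... | inj₂ y<fy = let l , l<y = >-unbounded y in l , f · y , (λ i → <-irrefl refl (proj₂ i)) , l<y , y<fy

    impossible : ∀ {u v} → In u v y → ¬ In u v (f · y) → ¬ Wandering g u v
    impossible {u} {v} y∈@(u<y , y<v) fy∉ wanders =
      let y₁ , y<y₁ , y₁<v = dense y<v
          h , h-above , h-below , hy≡y₁ = bump y∈ (<-trans u<y y<y₁ , y₁<v)
          h-off = ∉⇒fixed {g = h} h-above h-below
          a , b , ag , bg , kg , k≉ε = f⊥g h λ fh → <-irrefl
            (injective f (trans (sym (h-off fy∉)) (trans (sym (fh y)) (cong (f ·_) hy≡y₁)))) y<y₁
      in k≉ε (commutator-trivial a b h h-off g wanders ag bg kg)

  disjoint-image : ∀ (ψ : Autℚ ≅ Autℚ) {f g} → Disjoint f g → Disjoint (_≅_.⟦_⟧ ψ f) (_≅_.⟦_⟧ ψ g)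
  disjoint-image ψ {f} {g} f⊥g = algDisjoint⇒disjoint (_≅_.⟦_⟧ ψ f) (_≅_.⟦_⟧ ψ g)
    (AlgDisjoint-image ψ {f} {g} (disjoint⇒algDisjoint f g f⊥g))

  interval-bump : ∀ {u v} → u < v → ∃ λ g → Above u g × Below v g × ∃ λ x → g · x ≢ x
  interval-bump u<v =
    let x , u<x , x<v = dense u<v
        y , x<y , y<v = dense x<v
        g , g-above , g-below , gx≡y = bump (u<x , x<v) (<-trans u<x x<y , y<v)
    in g , g-above , g-below , x , λ gx≡x → <-irrefl (trans (sym gx≡x) gx≡y) x<y

  -- The relation is a parameter so that one induction serves for upper bounds inside a cut and for
  -- lower bounds outside it.
  list-bound : (S : ℚ → Set) (_⊰_ : ℚ → ℚ → Set) → (∀ {a b c} → a ⊰ b → b ⊰ c → a ⊰ c) →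
    ∃ S → (∀ {a b} → S a → S b → ∃ λ c → S c × a ⊰ c × b ⊰ c) →
    (L : List (ℚ × ℚ)) → ∃ λ d → S d × (∀ {p} → p ∈ L → S (proj₁ p) → proj₁ p ⊰ d)
  list-bound S _⊰_ ⊰-trans (s , Ss) directed [] = s , Ss , λ ()
  list-bound S _⊰_ ⊰-trans nonempty directed (p ∷ L)
    with list-bound S _⊰_ ⊰-trans nonempty directed L | em {S (proj₁ p)}
  ... | d , Sd , L<d | no ¬Sp = d , Sd , λ { (here refl) Sp → contradiction Sp ¬Sp ; (there i) → L<d i }
  ... | d , Sd , L<d | yes Sp =
    let e , Se , p<e , d<e = directed Sp Sd
    in e , Se , λ { (here refl) _ → p<e ; (there i) Sq → ⊰-trans (L<d i Sq) d<e }

  -- Reconstruction of points: the cut attached to z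

  module Reconstruction (ψ : Autℚ ≅ Autℚ) where
    open _≅_ ψ using (∙-homo; ⁻¹-homo; ε-homo) renaming
      (⟦_⟧ to ψ[_]; ⟦⟧-cong to ψ-cong; injective to ψ-injective; inv to ψ⁻¹; inverseˡ to ψψ⁻¹)

    infixr 7 _▷_
    _▷_ : Aut → ℚ → ℚ
    g ▷ z = ψ[ g ] · z

    ▷-cong : ∀ g h → g G.≈ h → ∀ z → g ▷ z ≡ h ▷ z
    ▷-cong g h = ψ-cong {g} {h}

    ▷-∙ : ∀ g h z → (g G.∙ h) ▷ z ≡ g ▷ h ▷ z
    ▷-∙ = ∙-homo

    ▷-inverseʳ : ∀ g z → g G.⁻¹ ▷ g ▷ z ≡ z
    ▷-inverseʳ g z = trans (⁻¹-homo g (g ▷ z)) (inverseʳ ψ[ g ] z)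

    ▷-inverseˡ : ∀ g z → g ▷ g G.⁻¹ ▷ z ≡ z
    ▷-inverseˡ g z = trans (cong (g ▷_) (⁻¹-homo g z)) (inverseˡ ψ[ g ] z)

    ▷-injective : ∀ g {z w} → g ▷ z ≡ g ▷ w → z ≡ w
    ▷-injective g = injective ψ[ g ]

    ▷-faithful : ∀ g → (∀ z → g ▷ z ≡ z) → g G.≈ G.ε
    ▷-faithful g p = ψ-injective {g} {G.ε} λ z → trans (p z) (sym (ε-homo z))

    ▷-transitive : ∀ z w → ∃ λ g → g ▷ z ≡ w
    ▷-transitive z w =
      let h , hz≡w , _ = move₂ (x<x+1 z) (x<x+1 w)
      in ψ⁻¹ h , trans (ψψ⁻¹ h z) hz≡w

    -- The cut of z: in the end, Lower z c and Upper z c will mean c ≤ θ z and θ z ≤ c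
    -- for the bijection θ that induces ψ⁻¹.
    Lower Upper : ℚ → ℚ → Set
    Lower z c = ∀ g → Below c g → g ▷ z ≡ z
    Upper z c = ∀ g → Above c g → g ▷ z ≡ z

    -- Some `l` supported below `c` has an image that moves `z`. Every `r` supported above `c` is
    -- disjoint from `l`, so the images are disjoint and that of `r` fixes `z`.
    ¬Lower⇒Upper : ∀ {z c} → ¬ Lower z c → Upper z c
    ¬Lower⇒Upper {z} {c} ¬lower r r-above =
      let l , ¬l-fixes = ¬∀⇒∃¬ ¬lower
          l-below  : Below c l
          l-below  = by-contradiction λ ¬below → ¬l-fixes λ below → contradiction (λ {x} → below {x}) ¬below
          l⊥r      = λ x → [ (λ x≤c → inj₂ (r-above x≤c)) , (λ c≤x → inj₁ (l-below c≤x)) ]′ (≤-total x c)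
      in [ (λ lz≡z → contradiction (λ _ → lz≡z) ¬l-fixes) , id ]′ (disjoint-image ψ {l} {r} l⊥r z)

    Lower-≤ : ∀ {z c d} → d ≤ c → Lower z c → Lower z d
    Lower-≤ d≤c lower g g-below = lower g λ c≤x → g-below (ℚ.≤-trans d≤c c≤x)

    Upper-≤ : ∀ {z c d} → c ≤ d → Upper z c → Upper z d
    Upper-≤ c≤d upper g g-above = upper g λ x≤c → g-above (ℚ.≤-trans x≤c c≤d)

    Lower<¬Lower : ∀ {z c d} → Lower z c → ¬ Lower z d → c < d
    Lower<¬Lower lower ¬lower = ≰⇒> λ d≤c → ¬lower (Lower-≤ d≤c lower)

    lowerPart-▷ : ∀ {z e} m (me : m · e ≡ e) → Upper z e → lowerPart e m me ▷ z ≡ m ▷ z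
    lowerPart-▷ {z} {e} m me upper =
      trans (cong (l ▷_) (sym (upper r (upperPart-Above e m me))))
        (trans (sym (▷-∙ l r z)) (▷-cong (l G.∙ r) m (lower∙upper e m me) z))
      where
      l = lowerPart e m me
      r = upperPart e m me

    -- Otherwise z would be fixed by all of Aut(ℚ), which is generated by the
    -- automorphisms supported above c together with those supported below d.
    Lower≤Upper : ∀ {z c d} → Lower z d → Upper z c → d ≤ c
    Lower≤Upper {z} {c} {d} lower upper = ≮⇒≥ λ c<d →
      let g , gz≡z+1 = ▷-transitive z (z ℚ.+ 1ℚ)
          _ , c<e , e<d = dense c<d
      in <-irrefl (trans (sym (all-fix c<e e<d g)) gz≡z+1) (x<x+1 z)
      where
      return : ∀ {e} → c < e → e < d → ∀ x → ∃ λ k → k ▷ z ≡ z × k · x ≡ e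
      return {e} c<e e<d x with c ℚ.<? x
      ... | yes c<x =
        let q , x<q , e<q = common-upper x e
            k , k-above , _ , kx≡e = bump (c<x , x<q) (c<e , e<q)
        in k , upper k k-above , kx≡e
      ... | no  c≮x =
        let p , p<x , p<e = common-lower x e
            k , _ , k-below , kx≡e = bump (p<x , ≤-<-trans (≮⇒≥ c≮x) (<-trans c<e e<d)) (p<e , e<d)
        in k , lower k k-below , kx≡e

      all-fix : ∀ {e} → c < e → e < d → ∀ g → g ▷ z ≡ z
      all-fix {e} c<e e<d g =
        let k , kz≡z , kge≡e = return c<e e<d (g · e)
            -- `m` fixes `e` and so splits there: the part above `e` fixes z by `upper`, the part
            -- below by `lower`. As `k` fixes z as well, so does `g`.
            m = k G.∙ g
        in ▷-injective k (trans (sym (▷-∙ k g z)) (trans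
             (trans (sym (lowerPart-▷ m kge≡e (Upper-≤ (<⇒≤ c<e) upper)))
               (Lower-≤ (<⇒≤ e<d) lower (lowerPart e m kge≡e) (lowerPart-Below e m kge≡e)))
             (sym kz≡z)))

    conjugate-fixes : ∀ g h z → (g G.⁻¹ G.∙ (h G.∙ g)) ▷ z ≡ z → h ▷ g ▷ z ≡ g ▷ z
    conjugate-fixes g h z p = trans (sym (▷-inverseˡ g (h ▷ g ▷ z))) (cong (g ▷_)
      (trans (cong (g G.⁻¹ ▷_) (sym (▷-∙ h g z))) (trans (sym (▷-∙ (g G.⁻¹) (h G.∙ g) z)) p)))

    Lower-image : ∀ g {z c} → Lower z c → Lower (g ▷ z) (g · c)
    Lower-image g {z} lower l l-below = conjugate-fixes g l z (lower (g G.⁻¹ G.∙ (l G.∙ g))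
      λ {x} c≤x → trans (cong (g G.⁻¹ ·_) (l-below (mono g c≤x))) (inverseʳ g x))

    Upper-image : ∀ g {z c} → Upper z c → Upper (g ▷ z) (g · c)
    Upper-image g {z} upper r r-above = conjugate-fixes g r z (upper (g G.⁻¹ G.∙ (r G.∙ g))
      λ {x} x≤c → trans (cong (g G.⁻¹ ·_) (r-above (mono g x≤c))) (inverseʳ g x))

    Lower-image⁻ : ∀ g {z c} → Lower (g ▷ z) (g · c) → Lower z c
    Lower-image⁻ g {z} {c} lower =
      subst₂ Lower (▷-inverseʳ g z) (inverseʳ g c) (Lower-image (g G.⁻¹) lower)

    Lower-preimage : ∀ g {z c} → Lower (g ▷ z) c → Lower z (g G.⁻¹ · c)
    Lower-preimage g {z} {c} lower =
      Lower-image⁻ g (subst (Lower (g ▷ z)) (sym (inverseˡ g c)) lower)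

    -- Otherwise `Upper z` would hold everywhere and, by transitivity, so would `Upper w` for all w.
    -- Then an automorphism supported above 0 would act trivially through `ψ`, against faithfulness.
    Lower-inhabited : ∀ z → ∃ (Lower z)
    Lower-inhabited z = by-contradiction λ none →
      let b , b-above , _ , x , bx≢x = interval-bump (x<x+1 0ℚ)
          b-fixes : ∀ w → b ▷ w ≡ w
          b-fixes w = let g , gz≡w = ▷-transitive z w in subst₂ Upper gz≡w (inverseˡ g 0ℚ)
            (Upper-image g (¬Lower⇒Upper λ lower → none (_ , lower))) b b-above
      in bx≢x (▷-faithful b b-fixes x)

    ¬Lower-inhabited : ∀ z → ∃ λ c → ¬ Lower z c
    ¬Lower-inhabited z = ¬∀⇒∃¬ λ all →
      let b , _ , b-below , x , bx≢x = interval-bump (x<x+1 0ℚ)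
          b-fixes : ∀ w → b ▷ w ≡ w
          b-fixes w = let g , gz≡w = ▷-transitive z w in subst₂ Lower gz≡w (inverseˡ g (0ℚ ℚ.+ 1ℚ))
            (Lower-image g (all (g G.⁻¹ · (0ℚ ℚ.+ 1ℚ)))) b b-below
      in bx≢x (▷-faithful b b-fixes x)

    -- Comparing the cuts of different points

    infix 4 _⊏_ _≐_
    _⊏_ _≐_ : ℚ → ℚ → Set
    x ⊏ y = ∃ λ c → Lower y c × ¬ Lower x c
    x ≐ y = ∀ c → (Lower x c → Lower y c) × (Lower y c → Lower x c)

    ≐-sym : ∀ {x y} → x ≐ y → y ≐ x
    ≐-sym x≐y c = proj₂ (x≐y c) , proj₁ (x≐y c)

    ⊏-respˡ-≐ : ∀ {x y z} → x ≐ y → x ⊏ z → y ⊏ z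
    ⊏-respˡ-≐ x≐y (c , lower , ¬lower) = c , lower , ¬lower ∘ proj₂ (x≐y c)

    ⊏-respʳ-≐ : ∀ {x y z} → x ≐ y → z ⊏ x → z ⊏ y
    ⊏-respʳ-≐ x≐y (c , lower , ¬lower) = c , proj₁ (x≐y c) lower , ¬lower

    ⊏-irrefl : ∀ {x} → ¬ x ⊏ x
    ⊏-irrefl (_ , lower , ¬lower) = ¬lower lower

    ⊏-cmp : ∀ x y → x ⊏ y ⊎ x ≐ y ⊎ y ⊏ x
    ⊏-cmp x y with em {x ⊏ y} | em {y ⊏ x}
    ... | yes x⊏y | _       = inj₁ x⊏y
    ... | no  _   | yes y⊏x = inj₂ (inj₂ y⊏x)
    ... | no  x⋢y | no y⋢x  = inj₂ (inj₁ λ c →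
      (λ lower → by-contradiction λ ¬lower → y⋢x (c , lower , ¬lower)) ,
      (λ lower → by-contradiction λ ¬lower → x⋢y (c , lower , ¬lower)))

    ⊏-image : ∀ g {x y} → x ⊏ y → g ▷ x ⊏ g ▷ y
    ⊏-image g (c , lower , ¬lower) = g · c , Lower-image g lower , ¬lower ∘ Lower-image⁻ g

    -- The doubtful case is that `c` is the maximum of the cut of y. Since y is `h ▷ x`, the cut of
    -- x then has the maximum h⁻¹ c, which is smaller than c, and everything between the two is
    -- available for `q`.
    ⊏-two-points : ∀ {x y} → x ⊏ y → ∃₂ λ q p → q < p × Lower y p × ¬ Lower x q
    ⊏-two-points {x} {y} (c , lower , ¬lower) with em {∃ λ p → c < p × Lower y p}
    ... | yes (p , c<p , lower-p) = c , p , c<p , lower-p , ¬lower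
    ... | no  c-max with ▷-transitive x y
    ...   | h , refl =
      let c₀<c = Lower<¬Lower (Lower-preimage h lower) ¬lower
          q , c₀<q , q<c = dense c₀<c
      in q , c , q<c , lower , λ lower-q → c-max (h · q
        , subst (_< h · q) (inverseˡ h c) (·-mono-< h c₀<q) , Lower-image h lower-q)

    -- If g maps the cut of x to that of x′, correct g by an automorphism s fixing x′ so
    -- that sg fixes a point p strictly between both cuts and the cut of y, and replace
    -- sg by the identity above p.
    move-fixing : ∀ {x x′ y} → x ⊏ y → x′ ⊏ y → ∃ λ m → m ▷ x ≡ x′ × m ▷ y ≡ y
    move-fixing {x} {x′} {y} x⊏y x′⊏y with common
      where
      common : ∃₂ λ q p → q < p × Lower y p × ¬ Lower x q × ¬ Lower x′ q
      common with ⊏-two-points x⊏y | ⊏-two-points x′⊏y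
      ... | q , p , q<p , lower , ¬lower | q′ , p′ , q′<p′ , lower′ , ¬lower′ with ≤-total q q′
      ...   | inj₁ q≤q′ = q′ , p′ , q′<p′ , lower′ , ¬lower ∘ Lower-≤ q≤q′ , ¬lower′
      ...   | inj₂ q′≤q = q , p , q<p , lower , ¬lower , ¬lower′ ∘ Lower-≤ q′≤q
    ... | q , p , q<p , lower-p , ¬lower-q , ¬lower′-q with ▷-transitive x x′
    ...   | g , refl =
      let r , r<p , r<gp , ¬lower′-r = common-point
          v , p<v , gp<v = common-upper p (g · p)
          s , s-above , _ , sgp≡p = bump (r<gp , gp<v) (r<p , p<v)
          m = s G.∙ g
      in lowerPart p m sgp≡p
       , trans (lowerPart-▷ m sgp≡p (¬Lower⇒Upper (¬lower-q ∘ Lower-≤ (<⇒≤ q<p))))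
           (trans (▷-∙ s g x) (¬Lower⇒Upper ¬lower′-r s s-above))
       , lower-p (lowerPart p m sgp≡p) (lowerPart-Below p m sgp≡p)
      where
      -- The larger of `q` and `g · q` lies outside the cut of `g ▷ x`, so automorphisms supported
      -- above it fix that point, and it leaves room below both `p` and `g · p`.
      common-point : ∃ λ r → r < p × r < g · p × ¬ Lower (g ▷ x) r
      common-point with ≤-total q (g · q)
      ... | inj₁ q≤gq = q , q<p , ≤-<-trans q≤gq (·-mono-< g q<p) , ¬lower′-q
      ... | inj₂ gq≤q = g · q , ≤-<-trans gq≤q q<p , ·-mono-< g q<p , ¬lower-q ∘ Lower-image⁻ g

    Monotone Antitone : Set
    Monotone = ∀ {x y} → x ⊏ y → x < y
    Antitone = ∀ {x y} → x ⊏ y → y < x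

    -- One pair on which the two orders agree decides for all: `h` carries y₀ to y, then `m` fixes y
    -- and carries h ▷ x₀ to x, and both act as increasing maps.
    monotone⊎antitone : Monotone ⊎ Antitone
    monotone⊎antitone with em {∃₂ λ x y → x ⊏ y × x < y}
    ... | no  none = inj₂ λ {x} {y} x⊏y → [ (λ x<y → contradiction (x , y , x⊏y , x<y) none) , id ]′
                       (≢⇒<⊎> λ { refl → ⊏-irrefl {x} x⊏y })
    ... | yes (x₀ , y₀ , x₀⊏y₀ , x₀<y₀) = inj₁ monotone
      where
      monotone : Monotone
      monotone {x} {y} x⊏y with ▷-transitive y₀ y
      ... | h , refl with move-fixing (⊏-image h x₀⊏y₀) x⊏y
      ...   | m , refl , my≡y =
        subst (m ▷ h ▷ x₀ <_) my≡y (·-mono-< ψ[ m ] (·-mono-< ψ[ h ] x₀<y₀))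

    ≐-convex : ∀ {x y t} → x ≐ y → x < t → t < y → x ≐ t
    ≐-convex {x} {y} {t} x≐y x<t t<y with ⊏-cmp x t | monotone⊎antitone
    ... | inj₂ (inj₁ x≐t) | _             = x≐t
    ... | inj₁ x⊏t        | inj₁ monotone = contradiction (monotone (⊏-respˡ-≐ x≐y x⊏t)) (<-asym t<y)
    ... | inj₁ x⊏t        | inj₂ antitone = contradiction (antitone x⊏t) (<-asym x<t)
    ... | inj₂ (inj₂ t⊏x) | inj₁ monotone = contradiction (monotone t⊏x) (<-asym x<t)
    ... | inj₂ (inj₂ t⊏x) | inj₂ antitone = contradiction (antitone (⊏-respʳ-≐ x≐y t⊏x)) (<-asym t<y)

    -- Translates of a single cut separate any two points. If g moved a, some `k ▷ 0ℚ` would have a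
    -- cut containing just the smaller of a and g a, and g could not preserve it.
    cut-preserving⇒trivial : ∀ g → (∀ w → w ≐ g ▷ w) → g G.≈ G.ε
    cut-preserving⇒trivial g preserves a = by-contradiction λ ga≢a →
      let c , lower = Lower-inhabited 0ℚ
          d , ¬lower = ¬Lower-inhabited 0ℚ
          c<d = Lower<¬Lower lower ¬lower
      in [ (λ ga<a → let k , kc≡ga , kd≡a = move₂ c<d ga<a in
             subst (¬_ ∘ Lower (k ▷ 0ℚ)) kd≡a (¬lower ∘ Lower-image⁻ k)
               (Lower-image⁻ g (proj₁ (preserves (k ▷ 0ℚ) (g · a))
                 (subst (Lower (k ▷ 0ℚ)) kc≡ga (Lower-image k lower)))))
         , (λ a<ga → let k , kc≡a , kd≡ga = move₂ c<d a<ga in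
             subst (¬_ ∘ Lower (k ▷ 0ℚ)) kd≡ga (¬lower ∘ Lower-image⁻ k)
               (proj₂ (preserves (k ▷ 0ℚ) (g · a))
                 (Lower-image g (subst (Lower (k ▷ 0ℚ)) kc≡a (Lower-image k lower)))))
         ]′ (≢⇒<⊎> ga≢a)

    -- Otherwise an automorphism moving only points strictly between x and y would
    -- preserve all cuts.
    ≐⇒≮ : ∀ {x y} → x ≐ y → ¬ x < y
    ≐⇒≮ {x} {y} x≐y x<y =
      let b , b-above , b-below , t , bt≢t = interval-bump x<y
          g = ψ⁻¹ b
          preserves : ∀ w → w ≐ b · w
          preserves w = stays b b-above b-below w
      in bt≢t (trans (sym (ψψ⁻¹ b t)) (trans
          (ψ-cong {g} {G.ε} (cut-preserving⇒trivial g λ w → subst (w ≐_) (sym (ψψ⁻¹ b w)) (preserves w)) t)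
          (ε-homo t)))
      where
      stays : ∀ b → Above x b → Below y b → ∀ w → w ≐ b · w
      stays b b-above b-below w with x ℚ.<? w | w ℚ.<? y
      ... | no  x≮w | _       = subst (w ≐_) (sym (b-above (≮⇒≥ x≮w))) λ _ → id , id
      ... | yes x<w | no  w≮y = subst (w ≐_) (sym (b-below (≮⇒≥ w≮y))) λ _ → id , id
      ... | yes x<w | yes w<y = λ c → proj₁ (x≐bw c) ∘ proj₂ (x≐w c) , proj₁ (x≐w c) ∘ proj₂ (x≐bw c)
        where
        x≐w  = ≐-convex x≐y x<w w<y
        x≐bw = ≐-convex x≐y (subst (_< b · w) (b-above ≤-refl) (·-mono-< b x<w))
                            (subst (b · w <_) (b-below ≤-refl) (·-mono-< b w<y))

    ≐⇒≡ : ∀ {x y} → x ≐ y → x ≡ y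
    ≐⇒≡ x≐y = by-contradiction λ x≢y → [ ≐⇒≮ x≐y , ≐⇒≮ (≐-sym x≐y) ]′ (≢⇒<⊎> x≢y)

    stabiliser : ∀ g {z} → (∀ c → Lower z c → Lower z (g · c)) → (∀ c → Lower z (g · c) → Lower z c) →
      g ▷ z ≡ z
    stabiliser g {z} forward backward = ≐⇒≡ λ c →
      (λ lower → subst (Lower z) (inverseˡ g c) (forward (g G.⁻¹ · c) (Lower-preimage g lower))) ,
      (λ lower → subst (Lower (g ▷ z)) (inverseˡ g c)
        (Lower-image g (backward (g G.⁻¹ · c) (subst (Lower z) (sym (inverseˡ g c)) lower))))

    -- The cut of a point is not a gap

    module _ {z} (empty : ¬ ∃ λ c → Lower z c × Upper z c) where

      -- Any `r` supported above a maximum c of the cut would preserve the cut and hence fix z by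
      -- `stabiliser`. So `Upper z c` would hold too, against `empty`.
      no-maximum : ∀ {c} → Lower z c → ∃ λ d → c < d × Lower z d
      no-maximum {c} lower = by-contradiction λ c-max →
        let ≤c : ∀ {e} → Lower z e → e ≤ c
            ≤c lower-e = ≮⇒≥ λ c<e → c-max (_ , c<e , lower-e)
        in empty (c , lower , λ r r-above →
          stabiliser r (λ e lower-e → subst (Lower z) (sym (r-above (≤c lower-e))) lower-e)
            (λ e lower-re → Lower-≤ (≮⇒≥ λ c<e → <-irrefl refl
              (≤-<-trans (≤c lower-re) (subst (_< r · e) (r-above ≤-refl) (·-mono-< r c<e)))) lower))

      no-minimum : ∀ {c} → ¬ Lower z c → ∃ λ d → d < c × ¬ Lower z d
      no-minimum {c} ¬lower = by-contradiction λ c-min →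
        let below : ∀ {e} → e < c → Lower z e
            below e<c = by-contradiction λ ¬lower-e → c-min (_ , e<c , ¬lower-e)
        in ¬lower λ l l-below →
          stabiliser l (λ e lower-e → below (subst (l · e <_) (l-below ≤-refl)
              (·-mono-< l (Lower<¬Lower lower-e ¬lower))))
            (λ e lower-le → below (·-cancel-< l (subst (l · e <_) (sym (l-below ≤-refl))
              (Lower<¬Lower lower-le ¬lower))))

      -- Such a pair on the graph of an automorphism shows that it does not carry the cut of z onto
      -- the cut of w.
      Separates : ℚ → ℚ × ℚ → Set
      Separates w (d , m) = Lower z d × ¬ Lower w m ⊎ ¬ Lower z d × Lower w m

      Lower-directed : ∀ {a b} → Lower z a → Lower z b → ∃ λ c → Lower z c × a < c × b < c
      Lower-directed {a} {b} lower-a lower-b with ≤-total a b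
      ... | inj₁ a≤b = let c , b<c , lower-c = no-maximum lower-b in c , lower-c , ≤-<-trans a≤b b<c , b<c
      ... | inj₂ b≤a = let c , a<c , lower-c = no-maximum lower-a in c , lower-c , a<c , ≤-<-trans b≤a a<c

      ¬Lower-directed : ∀ {a b} → ¬ Lower z a → ¬ Lower z b → ∃ λ c → ¬ Lower z c × c < a × c < b
      ¬Lower-directed {a} {b} ¬lower-a ¬lower-b with ≤-total a b
      ... | inj₁ a≤b = let c , c<a , ¬lower-c = no-minimum ¬lower-a in c , ¬lower-c , c<a , <-≤-trans c<a a≤b
      ... | inj₂ b≤a = let c , c<b , ¬lower-c = no-minimum ¬lower-b in c , ¬lower-c , <-≤-trans c<b b≤a , c<b

      abstract
        -- A gap leaves room on both sides: `d₀` in the cut and `d₁` outside it, both nearer to the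
        -- gap than the finite domain. Either may be sent to the same value `m`, and whether `m`
        -- lies in the cut of w decides which choice disagrees with it.
        separate : ∀ w C → Meets (Separates w) C
        separate w (L , coh) =
          let d₀ , lower-d₀ , L<d₀  = list-bound (Lower z) _<_ <-trans (Lower-inhabited z) Lower-directed L
              d₁ , ¬lower-d₁ , d₁<L = list-bound (¬_ ∘ Lower z) (λ x y → y < x) (λ p q → <-trans q p)
                                        (¬Lower-inhabited z) ¬Lower-directed L
              m , L<m , m<L         = interpolate proj₂ (Lower z ∘ proj₁) (¬_ ∘ Lower z ∘ proj₁) L L
                (λ i j lower ¬lower → ∼-mono (coherent coh i j) (Lower<¬Lower lower ¬lower))
          in extend lower-d₀ L<d₀ ¬lower-d₁ d₁<L L<m m<L
          where
          extend : ∀ {d₀ d₁ m} →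
            Lower z d₀ → (∀ {p} → p ∈ L → Lower z (proj₁ p) → proj₁ p < d₀) →
            ¬ Lower z d₁ → (∀ {p} → p ∈ L → ¬ Lower z (proj₁ p) → d₁ < proj₁ p) →
            (∀ {p} → p ∈ L → Lower z (proj₁ p) → proj₂ p < m) →
            (∀ {p} → p ∈ L → ¬ Lower z (proj₁ p) → m < proj₂ p) →
            Meets (Separates w) (L , coh)
          extend {d₀} {d₁} {m} lower-d₀ L<d₀ ¬lower-d₁ d₁<L L<m m<L = choose em
            where
            d₀<d₁ : d₀ < d₁
            d₀<d₁ = Lower<¬Lower lower-d₀ ¬lower-d₁
            new : ∀ d → d₀ ≤ d → d ≤ d₁ → ∀ {p} → p ∈ L → (d , m) ∼ p
            new d d₀≤d d≤d₁ {p} i with em {Lower z (proj₁ p)}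
            ... | yes lower = inj₂ (inj₂ (<-≤-trans (L<d₀ i lower) d₀≤d , L<m i lower))
            ... | no ¬lower = inj₂ (inj₁ (≤-<-trans d≤d₁ (d₁<L i ¬lower) , m<L i ¬lower))
            choose : Dec (Lower w m) → Meets (Separates w) (L , coh)
            choose (yes lower) = ((d₁ , m) ∷ L , All.tabulate (new d₁ (<⇒≤ d₀<d₁) ≤-refl) ∷ coh) , there
              , _ , here refl , inj₂ (¬lower-d₁ , lower)
            choose (no ¬lower) = ((d₀ , m) ∷ L , All.tabulate (new d₀ ≤-refl (<⇒≤ d₀<d₁)) ∷ coh) , there
              , _ , here refl , inj₁ (lower-d₀ , ¬lower)

    -- If the cut of z is a gap, back-and-forth gives an automorphism mapping this gap to
    -- one which is not among the countably many cuts of points w.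
    cut-inhabited : ∀ z → ∃ λ c → Lower z c × Upper z c
    cut-inhabited z = by-contradiction λ empty →
      let g , _ , separated = back-and-forth ([] , []) (λ n → Separates {z} empty (enumℚ n))
                                (λ n → separate {z} empty (enumℚ n))
          -- The point `g ▷ z` is itself among the w avoided, although its cut is the image under
          -- `g` of the cut of z.
          n , n-enum = enumℚ-surjective (g ▷ z)
      in impossible g (subst (λ w → ∃ λ d → Lower z d × ¬ Lower w (g · d) ⊎ ¬ Lower z d × Lower w (g · d))
           n-enum (separated n))
      where
      impossible : ∀ g → ¬ ∃ λ d →
        Lower z d × ¬ Lower (g ▷ z) (g · d) ⊎ ¬ Lower z d × Lower (g ▷ z) (g · d)
      impossible g (_ , inj₁ (lower , ¬lower)) = ¬lower (Lower-image g lower)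
      impossible g (_ , inj₂ (¬lower , lower)) = ¬lower (Lower-image⁻ g lower)

    -- The bijection attached to the automorphism

    abstract
      θ : ℚ → ℚ
      θ z = proj₁ (cut-inhabited z)

      Lower-θ : ∀ z → Lower z (θ z)
      Lower-θ z = proj₁ (proj₂ (cut-inhabited z))

      Upper-θ : ∀ z → Upper z (θ z)
      Upper-θ z = proj₂ (proj₂ (cut-inhabited z))

    θ-equivariant : ∀ g z → θ (g ▷ z) ≡ g · θ z
    θ-equivariant g z = ≤-antisym
      (Lower≤Upper (Lower-θ (g ▷ z)) (Upper-image g (Upper-θ z)))
      (Lower≤Upper (Lower-image g (Lower-θ z)) (Upper-θ (g ▷ z)))

    -- By equivariance, any g with g · θ 0 = c yields the preimage `g ▷ 0ℚ` of c; transitivity of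
    -- Aut(ℚ) thus makes `θ` onto.
    θ⁻ : ℚ → ℚ
    θ⁻ c = proj₁ (move₂ (x<x+1 (θ 0ℚ)) (x<x+1 c)) ▷ 0ℚ

    θ-θ⁻ : ∀ c → θ (θ⁻ c) ≡ c
    θ-θ⁻ c = let g , gθ≡c , _ = move₂ (x<x+1 (θ 0ℚ)) (x<x+1 c) in trans (θ-equivariant g 0ℚ) gθ≡c

    ⊏⊎⊐ : ∀ {x y} → x < y → θ x < θ y × x ⊏ y ⊎ θ y < θ x × y ⊏ x
    ⊏⊎⊐ {x} {y} x<y with <-cmp (θ x) (θ y)
    ... | tri< θx<θy _ _ = inj₁ (θx<θy , θ y , Lower-θ y ,
      λ lower → <-irrefl refl (<-≤-trans θx<θy (Lower≤Upper lower (Upper-θ x))))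
    ... | tri> _ _ θy<θx = inj₂ (θy<θx , θ x , Lower-θ x ,
      λ lower → <-irrefl refl (<-≤-trans θy<θx (Lower≤Upper lower (Upper-θ y))))
    ... | tri≈ _ θx≡θy _ = contradiction x<y (≐⇒≮ λ c →
      (λ lower → Lower-≤ (Lower≤Upper lower (Upper-θ x)) (subst (Lower y) (sym θx≡θy) (Lower-θ y))) ,
      (λ lower → Lower-≤ (Lower≤Upper lower (Upper-θ y)) (subst (Lower x) θx≡θy (Lower-θ x))))

    θ-monotone⊎antitone : (∀ {x y} → x < y → θ x < θ y) ⊎ (∀ {x y} → x < y → θ y < θ x)
    θ-monotone⊎antitone with monotone⊎antitone
    ... | inj₁ monotone = inj₁ λ {x} {y} x<y →
      [ proj₁ , (λ (_ , y⊏x) → contradiction (monotone y⊏x) (<-asym x<y)) ]′ (⊏⊎⊐ x<y)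
    ... | inj₂ antitone = inj₂ λ {x} {y} x<y →
      [ (λ (_ , x⊏y) → contradiction (antitone x⊏y) (<-asym x<y)) , proj₁ ]′ (⊏⊎⊐ x<y)

  -- Uniqueness and existence of the inducing permutation

  separating : ∀ {x y} → x ≢ y → ∃ λ g → g · x ≡ x × g · y ≢ y
  separating {x} {y} x≢y with ≢⇒<⊎> x≢y
  ... | inj₁ x<y =
    let v , y<v = <-unbounded y
        z , y<z , z<v = dense y<v
        g , g-above , _ , gy≡z = bump (x<y , y<v) (<-trans x<y y<z , z<v)
    in g , g-above ≤-refl , λ gy≡y → <-irrefl (trans (sym gy≡y) gy≡z) y<z
  ... | inj₂ y<x =
    let u , u<y = >-unbounded y
        z , y<z , z<x = dense y<x
        g , _ , g-below , gy≡z = bump (u<y , y<x) (<-trans u<y y<z , z<x)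
    in g , g-below ≤-refl , λ gy≡y → <-irrefl (trans (sym gy≡y) gy≡z) y<z

  -- The permutation σ q⁻¹ ∘ σ p commutes with every g. It therefore sends x to a point fixed by the
  -- whole stabiliser of x, and by `separating` that point is x.
  inducing-unique : ∀ p q φ χ → Induces p φ → Induces q χ → φ Γ.≈ χ → p S.≈ q
  inducing-unique p q φ χ p↝φ q↝χ φ≈χ = σ-faithful p q λ x → by-contradiction λ σpx≢σqx →
    let σqx′≡σpx = σ-σ⁻ q (σ p x)
        g , gx≡x , gx′≢x′ = separating {x} {σ⁻ q (σ p x)} λ x≡x′ → σpx≢σqx
          (trans (sym σqx′≡σpx) (cong (σ q) (sym x≡x′)))
    in gx′≢x′ (σ-injective q (trans (sym (q↝χ g _)) (trans (cong (_≅_.⟦_⟧ χ g ·_) σqx′≡σpx)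
         (trans (sym (φ≈χ g (σ p x))) (trans (p↝φ g x) (trans (cong (σ p) gx≡x) (sym σqx′≡σpx)))))))

  abstract
    inducing : ∀ φ → ∃ λ p → Induces p φ
    inducing φ = [ increasing , decreasing ]′ θ-monotone⊎antitone
      where
      -- Applied to the inverse of φ, equivariance of `θ` reads φ(g) θ = θ g, which is the form that
      -- `Induces` asks for.
      open Reconstruction (φ Γ.⁻¹)

      intertwines : ∀ g z → _≅_.⟦_⟧ φ g · θ z ≡ θ (g · z)
      intertwines g z = trans (sym (θ-equivariant (_≅_.⟦_⟧ φ g) z)) (cong θ (_≅_.inverseʳ φ g z))

      increasing : (∀ {x y} → x < y → θ x < θ y) → ∃ λ p → Induces p φ
      increasing θ-mono = (mkAut θ θ⁻ θ-mono θ-θ⁻ , 0ℙ) , intertwines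

      decreasing : (∀ {x y} → x < y → θ y < θ x) → ∃ λ p → Induces p φ
      decreasing θ-anti =
        -- θ after negation is increasing; the parity `1ℙ` negates once more, so the signed
        -- permutation is `θ` again.
        (mkAut (θ ∘ -_) (-_ ∘ θ⁻) (θ-anti ∘ ℚ.neg-antimono-<)
          (λ y → trans (cong θ (neg-involutive (θ⁻ y))) (θ-θ⁻ y)) , 1ℙ) ,
        λ g x → trans (cong (λ y → _≅_.⟦_⟧ φ g · θ y) (neg-involutive x))
          (trans (intertwines g x) (cong θ (sym (neg-involutive (g · x)))))

corollary1p6 : ExcludedMiddle 0ℓ → GroupAut Autℚ ≅ SemidirectProduct Autℚ ℤ₂ negAction
corollary1p6 em = record
  { ⟦_⟧ = Φ
  ; isGroupIsomorphism = record
    { isGroupMonomorphism = record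
      { isGroupHomomorphism = record
        { isMonoidHomomorphism = record
          { isMagmaHomomorphism = record
            { isRelHomomorphism = record { cong = λ {φ} {χ} → Φ-unique φ χ (Φ χ) (Φ-induces χ) }
            ; homo = λ φ χ → Φ-unique (φ Γ.∙ χ) (φ Γ.∙ χ) (Φ φ S.∙ Φ χ)
                (Induces-∙ (Φ φ) (Φ χ) φ χ (Φ-induces φ) (Φ-induces χ)) (λ _ _ → refl)
            }
          ; ε-homo = Φ-unique Γ.ε Γ.ε S.ε (λ _ _ → refl) (λ _ _ → refl)
          }
        ; ⁻¹-homo = λ φ → Φ-unique (φ Γ.⁻¹) (φ Γ.⁻¹) (Φ φ S.⁻¹)
            (Induces-⁻¹ (Φ φ) φ (Φ-induces φ)) (λ _ _ → refl)
        }
      ; injective = λ {φ} {χ} → induced-unique (Φ φ) (Φ χ) φ χ (Φ-induces φ) (Φ-induces χ)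
      }
    ; surjective = λ p → proj₁ (induced p) ,
        λ {φ} → Φ-unique φ (proj₁ (induced p)) p (proj₂ (induced p))
    }
  }
  where
  Φ : Γ.Carrier → S.Carrier
  Φ φ = proj₁ (inducing em φ)

  Φ-induces : ∀ φ → Induces (Φ φ) φ
  Φ-induces φ = proj₂ (inducing em φ)

  -- Each law of the isomorphism comes from exhibiting a p that induces the right automorphism; `Φ`
  -- must then take the value p.
  Φ-unique : ∀ φ χ p → Induces p χ → φ Γ.≈ χ → Φ φ S.≈ p
  Φ-unique φ χ p p↝χ = inducing-unique em (Φ φ) p φ χ (Φ-induces φ) p↝χ
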